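{- For all $\alpha\in\mathcal C$, $$\widetilde\omega\big(\overleftarrow{\mathbf e}_\alpha\big)=\overleftarrow{\mathbf h}_{\widehat\alpha},\qquad \widetilde\omega\big(\overleftarrow{\mathbf h}_\alpha\big)=\overleftarrow{\mathbf e}_{\widehat\alpha}.$$
   Context: Ring. $\Lambda^-=\Lambda(\ldots,x_{ -1},x_0)$ is the ring of symmetric functions over $\mathbb Q$ in the variables $x_i$, $i\le 0$, and $\mathcal R=\Lambda^-\otimes_{\mathbb Q}\mathbb Q[x_i\mid i\in\mathbb Z]$, identified via multiplication with a ring of bounded-degree formal power series in the variables $x_i$, $i\in\mathbb Z$. For every $k\in\mathbb Z$ and $d\ge 0$ the elementary and complete homogeneous symmetric functions $\mathbf e_d(\ldots,x_{k-1},x_k)$, $\mathbf h_d(\ldots,x_{k-1},x_k)$ in the variables $x_i$, $i\le k$, lie in $\mathcal R$. Back stable SEMs and CHMs. $\mathcal C$ is the set of finitely supported tuples $\alpha=(\alpha_i)_{i\in\mathbb Z}$ of nonnegative integers. For $\alpha\in\mathcal C$, $\overleftarrow{\mathbf e}_\alpha=\prod_{i\in\mathbb Z}\mathbf e_{\alpha_i}(\ldots,x_{i-1},x_i)$ and $\overleftarrow{\mathbf h}_\alpha=\prod_{i\in\mathbb Z}\mathbf h_{\alpha_i}(\ldots,x_{i-1},x_i)$. The reversal of $\alpha$ is $\widehat\alpha_i=\alpha_{ -i}$. The involution. $\widetilde\omega:\mathcal R\to\mathcal R$ is the $\mathbb Q$-algebra involution (Lam–Lee–Shimozono) determined by $\widetilde\omega(e_r)=h_r$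 for $r\ge 1$, where $e_r=\mathbf e_r(\ldots,x_{ -1},x_0)$ and $h_r=\mathbf h_r(\ldots,x_{ -1},x_0)$ in $\Lambda^-$, and $\widetilde\omega(x_i)=-x_{1-i}$ for every $i\in\mathbb Z$ (on the polynomial tensor factor). -}

module Defs where

open import Algebra.Bundles using (CommutativeRing)
open import Algebra.Morphism.Structures using (module RingMorphisms)
open import Data.Bool.Base using (if_then_else_)
open import Data.Integer.Base as ℤ using (ℤ; -[1+_]; ∣_∣)
import Data.Integer.Properties as ℤ
open import Data.List.Base using (List; []; _∷_; _++_; map; filter; foldr; cartesianProductWith)
open import Data.Nat.ListAction using (sum)
open import Data.Nat.ListAction.Properties using (sum-↭)
open import Data.List.Membership.Propositional using (_∈_; _∉_)
open import Data.List.Membership.Propositional.Properties using (∈-filter⁺; ∈-filter⁻; ∈-map⁺)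
open import Data.List.Properties using (filter-accept; filter-reject)
import Data.List.Membership.DecPropositional as DecMembership
open import Data.List.Membership.Propositional.Properties.WithK using (unique∧set⇒bag)
open import Data.List.Relation.Binary.BagAndSetEquality using (∼bag⇒↭)
open import Data.List.Relation.Binary.Permutation.Propositional as Perm using (_↭_)
import Data.List.Relation.Binary.Permutation.Propositional.Properties as Perm
open import Data.List.Relation.Unary.All as All using (All; []; _∷_)
open import Data.List.Relation.Unary.Any as Any using (Any; here; there)
import Data.List.Relation.Unary.Any.Properties as Any
import Data.List.Relation.Unary.AllPairs as AllPairs
open import Data.List.Relation.Unary.Unique.Propositional using (Unique)
import Data.List.Relation.Unary.Unique.Propositional.Properties as Unique
open import Data.Nat.Base as ℕ using (ℕ; zero; suc; z≤n)
import Data.Nat.Properties as ℕ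
open import Data.Product.Base using (_×_; _,_; proj₁; proj₂; ∃)
open import Data.Rational.Base using (ℚ; 0ℚ; 1ℚ; _+_; _*_; -_)
import Data.Rational.Properties as ℚ
open import Function.Base using (_∘_; flip)
open import Function.Bundles using (_↔_; Inverse; mk⇔)
open import Level using (0ℓ)
open import Relation.Binary.PropositionalEquality
open import Relation.Binary.Bundles using (Setoid)
open import Relation.Binary.Structures using (IsEquivalence)
open import Relation.Nullary using (¬_; Dec; yes; no; does; contradiction)
open import Relation.Nullary.Decidable using (map′; _×-dec_; _→-dec_; ¬?; dec-true; dec-false; decidable-stable)

open DecMembership ℤ._≟_ using (_∈?_)
open ≡-Reasoning

-- Serves both as the index set 𝒞 and as the exponent vectors of monomials in
-- the variables x_i, i ∈ ℤ.
record FinSupp : Set where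
  field
    at     : ℤ → ℕ
    bound  : ℕ
    vanish : ∀ i → bound ℕ.< ∣ i ∣ → at i ≡ 0

open FinSupp public

infix 4 _≈ᴹ_

_≈ᴹ_ : FinSupp → FinSupp → Set
a ≈ᴹ b = ∀ i → at a i ≡ at b i

window : ℕ → List ℤ
window zero    = ℤ.+ 0 ∷ []
window (suc n) = ℤ.+ suc n ∷ -[1+ n ] ∷ window n

supp : FinSupp → List ℤ
supp a = window (bound a)

reversal : FinSupp → FinSupp
reversal a = record
  { at     = λ i → at a (ℤ.- i)
  ; bound  = bound a
  ; vanish = λ i b<i → vanish a (ℤ.- i) (subst (bound a ℕ.<_) (sym (ℤ.∣-i∣≡∣i∣ i)) b<i)
  }

𝟘 : FinSupp
𝟘 = record { at = λ _ → 0 ; bound = 0 ; vanish = λ _ _ → refl }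

infixl 6 _⊕_

_⊕_ : FinSupp → FinSupp → FinSupp
a ⊕ b = record
  { at     = λ i → at a i ℕ.+ at b i
  ; bound  = bound a ℕ.⊔ bound b
  ; vanish = λ i p → cong₂ ℕ._+_ (vanish a i (ℕ.≤-<-trans (ℕ.m≤m⊔n _ _) p))
                                 (vanish b i (ℕ.≤-<-trans (ℕ.m≤n⊔m (bound a) _) p))
  }

-- The exponent vector of x_i ^ n.
single : ℤ → ℕ → FinSupp
single i n = record
  { at     = λ l → if does (l ℤ.≟ i) then n else 0
  ; bound  = ∣ i ∣
  ; vanish = λ l p → cong (if_then n else 0) (dec-false (l ℤ.≟ i) (λ { refl → ℕ.<-irrefl refl p }))
  }

degree : FinSupp → ℕ
degree a = sum (map (at a) (supp a))

single-at : ∀ i n → at (single i n) i ≡ n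
single-at i n = cong (if_then n else 0) (dec-true (i ℤ.≟ i) refl)

single-off : ∀ {i l} n → l ≢ i → at (single i n) l ≡ 0
single-off {i} {l} n l≢i = cong (if_then n else 0) (dec-false (l ℤ.≟ i) l≢i)

∈-window : ∀ n i → ∣ i ∣ ℕ.≤ n → i ∈ window n
∈-window zero    (ℤ.+ zero)  p = here refl
∈-window (suc n) (ℤ.+ m)     p with m ℕ.≟ suc n
... | yes refl = here refl
... | no  m≢   = there (there (∈-window n (ℤ.+ m) (ℕ.≤-pred (ℕ.≤∧≢⇒< p m≢))))
∈-window (suc n) -[1+ m ] p with m ℕ.≟ n
... | yes refl = there (here refl)
... | no  m≢   = there (there (∈-window n -[1+ m ] (ℕ.≤∧≢⇒< (ℕ.≤-pred p) m≢)))

window-bound : ∀ n → All (λ i → ∣ i ∣ ℕ.≤ n) (window n)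
window-bound zero    = z≤n ∷ []
window-bound (suc n) = ℕ.≤-refl ∷ ℕ.≤-refl ∷ All.map ℕ.m≤n⇒m≤1+n (window-bound n)

window-unique : ∀ n → Unique (window n)
window-unique zero    = [] AllPairs.∷ AllPairs.[]
window-unique (suc n) =
  ((λ ()) ∷ All.map (λ { p refl → ℕ.<-irrefl refl p }) (window-bound n)) AllPairs.∷
  (All.map (λ { p refl → ℕ.<-irrefl refl p }) (window-bound n) AllPairs.∷ window-unique n)

SuppIn : List ℤ → (ℤ → ℕ) → Set
SuppIn L m = ∀ i → i ∉ L → m i ≡ 0

supp-covers : ∀ a → SuppIn (supp a) (at a)
supp-covers a i i∉ with ∣ i ∣ ℕ.≤? bound a
... | yes p = contradiction (∈-window _ i p) i∉
... | no  p = vanish a i (ℕ.≰⇒> p)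

supp-unique : ∀ a → Unique (supp a)
supp-unique a = window-unique (bound a)

∀supp? : ∀ a {P : ℤ → Set} → (∀ i → at a i ≡ 0 → P i) → (∀ i → Dec (P i)) → Dec (∀ i → P i)
∀supp? a {P} P0 P? = map′ to (λ p → All.tabulate (λ {i} _ → p i)) (All.all? P? (supp a))
  where
  to : All P (supp a) → ∀ i → P i
  to ps i with i ∈? supp a
  ... | yes i∈ = All.lookup ps i∈
  ... | no  i∉ = P0 i (supp-covers a i i∉)

_≈ᴹ?_ : ∀ a b → Dec (a ≈ᴹ b)
a ≈ᴹ? b = ∀supp? (a ⊕ b) (λ i p → trans (ℕ.m+n≡0⇒m≡0 _ p) (sym (ℕ.m+n≡0⇒n≡0 (at a i) p)))
                 (λ i → at a i ℕ.≟ at b i)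

nonzero? : (m : ℤ → ℕ) → ∀ i → Dec (m i ≢ 0)
nonzero? m i = ¬? (m i ℕ.≟ 0)

filter-↭ : ∀ {L L′} m → Unique L → Unique L′ → SuppIn L m → SuppIn L′ m →
           filter (nonzero? m) L ↭ filter (nonzero? m) L′
filter-↭ {L} {L′} m u u′ c c′ = ∼bag⇒↭ (unique∧set⇒bag
  (Unique.filter⁺ (nonzero? m) u) (Unique.filter⁺ (nonzero? m) u′) (mk⇔ (go L L′ c′) (go L′ L c)))
  where
  go : ∀ L L′ → SuppIn L′ m → ∀ {i} → i ∈ filter (nonzero? m) L → i ∈ filter (nonzero? m) L′
  go L L′ c {i} i∈ with ∈-filter⁻ (nonzero? m) {xs = L} i∈
  ... | _ , m≢0 = ∈-filter⁺ (nonzero? m) (decidable-stable (i ∈? L′) (λ i∉ → m≢0 (c i i∉))) m≢0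

sum-filter : ∀ m L → sum (map m L) ≡ sum (map m (filter (nonzero? m) L))
sum-filter m [] = refl
sum-filter m (i ∷ L) with m i ℕ.≟ 0
... | yes p = begin
  m i ℕ.+ sum (map m L)                       ≡⟨ cong (ℕ._+ sum (map m L)) p ⟩
  sum (map m L)                               ≡⟨ sum-filter m L ⟩
  sum (map m (filter (nonzero? m) L))         ≡⟨ cong (sum ∘ map m) (filter-reject (nonzero? m) {xs = L} (λ q → q p)) ⟨
  sum (map m (filter (nonzero? m) (i ∷ L)))   ∎
... | no  p = begin
  m i ℕ.+ sum (map m L)                       ≡⟨ cong (m i ℕ.+_) (sum-filter m L) ⟩
  m i ℕ.+ sum (map m (filter (nonzero? m) L)) ≡⟨ cong (sum ∘ map m) (filter-accept (nonzero? m) {xs = L} p) ⟨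
  sum (map m (filter (nonzero? m) (i ∷ L)))   ∎

sum-cover : ∀ {L L′} m → Unique L → Unique L′ → SuppIn L m → SuppIn L′ m →
            sum (map m L) ≡ sum (map m L′)
sum-cover {L} {L′} m u u′ c c′ = begin
  sum (map m L)                         ≡⟨ sum-filter m L ⟩
  sum (map m (filter (nonzero? m) L))   ≡⟨ sum-↭ (Perm.map⁺ m (filter-↭ m u u′ c c′)) ⟩
  sum (map m (filter (nonzero? m) L′))  ≡⟨ sum-filter m L′ ⟨
  sum (map m L′)                        ∎

sum-map-cong : ∀ {m m′ : ℤ → ℕ} (L : List ℤ) → (∀ i → m i ≡ m′ i) → sum (map m L) ≡ sum (map m′ L)
sum-map-cong []      p = refl
sum-map-cong (i ∷ L) p = cong₂ ℕ._+_ (p i) (sum-map-cong L p)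

sum-map-+ : ∀ (m m′ : ℤ → ℕ) L → sum (map (λ i → m i ℕ.+ m′ i) L) ≡ sum (map m L) ℕ.+ sum (map m′ L)
sum-map-+ m m′ []      = refl
sum-map-+ m m′ (i ∷ L) = begin
  m i ℕ.+ m′ i ℕ.+ sum (map _ L)       ≡⟨ cong (m i ℕ.+ m′ i ℕ.+_) (sum-map-+ m m′ L) ⟩
  m i ℕ.+ m′ i ℕ.+ (s ℕ.+ s′)          ≡⟨ ℕ.+-assoc (m i) (m′ i) _ ⟩
  m i ℕ.+ (m′ i ℕ.+ (s ℕ.+ s′))        ≡⟨ cong (m i ℕ.+_) (ℕ.+-assoc (m′ i) s s′) ⟨
  m i ℕ.+ (m′ i ℕ.+ s ℕ.+ s′)          ≡⟨ cong (λ z → m i ℕ.+ (z ℕ.+ s′)) (ℕ.+-comm (m′ i) s) ⟩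
  m i ℕ.+ (s ℕ.+ m′ i ℕ.+ s′)          ≡⟨ cong (m i ℕ.+_) (ℕ.+-assoc s (m′ i) s′) ⟩
  m i ℕ.+ (s ℕ.+ (m′ i ℕ.+ s′))        ≡⟨ ℕ.+-assoc (m i) s _ ⟨
  m i ℕ.+ s ℕ.+ (m′ i ℕ.+ s′)          ∎
  where
  s s′ : ℕ
  s  = sum (map m L)
  s′ = sum (map m′ L)

degree-cover : ∀ a {L} → Unique L → SuppIn L (at a) → degree a ≡ sum (map (at a) L)
degree-cover a u c = sum-cover (at a) (supp-unique a) u (supp-covers a) c

degree-cong : ∀ {a b} → a ≈ᴹ b → degree a ≡ degree b
degree-cong {a} {b} p = trans
  (degree-cover a (supp-unique b) (λ i i∉ → trans (p i) (supp-covers b i i∉)))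
  (sum-map-cong (supp b) p)

degree-⊕ : ∀ a b → degree (a ⊕ b) ≡ degree a ℕ.+ degree b
degree-⊕ a b = trans (sum-map-+ (at a) (at b) (supp (a ⊕ b))) (cong₂ ℕ._+_
  (sym (degree-cover a (supp-unique (a ⊕ b)) (λ i i∉ → ℕ.m+n≡0⇒m≡0 _ (supp-covers (a ⊕ b) i i∉))))
  (sym (degree-cover b (supp-unique (a ⊕ b)) (λ i i∉ → ℕ.m+n≡0⇒n≡0 (at a i) (supp-covers (a ⊕ b) i i∉)))))

degree-single : ∀ i n → degree (single i n) ≡ n
degree-single i n = begin
  degree (single i n)         ≡⟨ degree-cover (single i n) {i ∷ []} ([] AllPairs.∷ AllPairs.[])
                                   (λ l l∉ → single-off n (λ l≡i → l∉ (here l≡i))) ⟩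
  at (single i n) i ℕ.+ 0     ≡⟨ ℕ.+-identityʳ _ ⟩
  at (single i n) i           ≡⟨ single-at i n ⟩
  n                           ∎

degree≡0 : ∀ a → degree a ≡ 0 → a ≈ᴹ 𝟘
degree≡0 a p i with i ∈? supp a
... | no  i∉ = supp-covers a i i∉
... | yes i∈ = go (supp a) p i∈
  where
  go : ∀ L → sum (map (at a) L) ≡ 0 → i ∈ L → at a i ≡ 0
  go (l ∷ L) q (here refl) = ℕ.m+n≡0⇒m≡0 _ q
  go (l ∷ L) q (there i∈) = go L (ℕ.m+n≡0⇒n≡0 (at a l) q) i∈

SuppIn-relabel : (σ : ℤ ↔ ℤ) {m m′ : ℤ → ℕ} → (∀ i → m′ i ≡ m (Inverse.to σ i)) →
                 ∀ {L} → SuppIn L m′ → SuppIn (map (Inverse.to σ) L) m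
SuppIn-relabel σ {m} {m′} p {L} c i i∉ = begin
  m i                                   ≡⟨ cong m (Inverse.strictlyInverseˡ σ i) ⟨
  m (Inverse.to σ (Inverse.from σ i))   ≡⟨ p (Inverse.from σ i) ⟨
  m′ (Inverse.from σ i)                 ≡⟨ c (Inverse.from σ i) (λ j∈ → i∉
                                            (subst (_∈ map (Inverse.to σ) L) (Inverse.strictlyInverseˡ σ i)
                                              (∈-map⁺ (Inverse.to σ) j∈))) ⟩
  0                                     ∎

to-injective : (σ : ℤ ↔ ℤ) → ∀ {i j} → Inverse.to σ i ≡ Inverse.to σ j → i ≡ j
to-injective σ {i} {j} p = begin
  i                                 ≡⟨ Inverse.strictlyInverseʳ σ i ⟨
  Inverse.from σ (Inverse.to σ i)   ≡⟨ cong (Inverse.from σ) p ⟩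
  Inverse.from σ (Inverse.to σ j)   ≡⟨ Inverse.strictlyInverseʳ σ j ⟩
  j                                 ∎

degree-relabel : (σ : ℤ ↔ ℤ) → ∀ a b → (∀ i → at b i ≡ at a (Inverse.to σ i)) → degree b ≡ degree a
degree-relabel σ a b p = trans (go (supp b)) (sym (degree-cover a
    (Unique.map⁺ (to-injective σ) (supp-unique b)) (SuppIn-relabel σ p (supp-covers b))))
  where
  go : ∀ L → sum (map (at b) L) ≡ sum (map (at a) (map (Inverse.to σ) L))
  go []      = refl
  go (i ∷ L) = cong₂ ℕ._+_ (p i) (go L)

-- The sum of F j k over all j + k = n.
∑₂ : ℕ → (ℕ → ℕ → ℚ) → ℚ
∑₂ zero    F = F 0 0
∑₂ (suc n) F = F 0 (suc n) + ∑₂ n (λ j k → F (suc j) k)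

-- For a duplicate-free list L, the sum of F a b over all pairs of exponent
-- vectors a, b supported in L such that a + b agrees with m on L.
∑split : List ℤ → (ℤ → ℕ) → (FinSupp → FinSupp → ℚ) → ℚ
∑split []      m F = F 𝟘 𝟘
∑split (i ∷ L) m F = ∑₂ (m i) λ j k → ∑split L m λ a b → F (single i j ⊕ a) (single i k ⊕ b)

∑₂-cong : ∀ n {F G} → (∀ j k → j ℕ.+ k ≡ n → F j k ≡ G j k) → ∑₂ n F ≡ ∑₂ n G
∑₂-cong zero    p = p 0 0 refl
∑₂-cong (suc n) p = cong₂ _+_ (p 0 (suc n) refl) (∑₂-cong n (λ j k q → p (suc j) k (cong suc q)))

∑₂-0 : ∀ n → ∑₂ n (λ _ _ → 0ℚ) ≡ 0ℚ
∑₂-0 zero    = refl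
∑₂-0 (suc n) = trans (ℚ.+-identityˡ _) (∑₂-0 n)

+-interchange : ∀ a b c d → (a + b) + (c + d) ≡ (a + c) + (b + d)
+-interchange a b c d = begin
  (a + b) + (c + d)   ≡⟨ ℚ.+-assoc a b (c + d) ⟩
  a + (b + (c + d))   ≡⟨ cong (a +_) (ℚ.+-assoc b c d) ⟨
  a + (b + c + d)     ≡⟨ cong (λ z → a + (z + d)) (ℚ.+-comm b c) ⟩
  a + (c + b + d)     ≡⟨ cong (a +_) (ℚ.+-assoc c b d) ⟩
  a + (c + (b + d))   ≡⟨ ℚ.+-assoc a c (b + d) ⟨
  (a + c) + (b + d)   ∎

∑₂-+ : ∀ n F G → ∑₂ n (λ j k → F j k + G j k) ≡ ∑₂ n F + ∑₂ n G
∑₂-+ zero    F G = refl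
∑₂-+ (suc n) F G = trans
  (cong (F 0 (suc n) + G 0 (suc n) +_) (∑₂-+ n (λ j k → F (suc j) k) (λ j k → G (suc j) k)))
  (+-interchange (F 0 (suc n)) (G 0 (suc n)) (∑₂ n (λ j k → F (suc j) k)) (∑₂ n (λ j k → G (suc j) k)))

∑₂-* : ∀ n c F → ∑₂ n (λ j k → c * F j k) ≡ c * ∑₂ n F
∑₂-* zero    c F = refl
∑₂-* (suc n) c F = trans (cong (c * F 0 (suc n) +_) (∑₂-* n c (λ j k → F (suc j) k)))
                         (sym (ℚ.*-distribˡ-+ c (F 0 (suc n)) (∑₂ n (λ j k → F (suc j) k))))

∑₂-snoc : ∀ n F → ∑₂ (suc n) F ≡ ∑₂ n (λ j k → F j (suc k)) + F (suc n) 0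
∑₂-snoc zero    F = refl
∑₂-snoc (suc n) F = trans (cong (F 0 (suc (suc n)) +_) (∑₂-snoc n (λ j k → F (suc j) k)))
                          (sym (ℚ.+-assoc (F 0 (suc (suc n))) (∑₂ n (λ j k → F (suc j) (suc k))) (F (suc (suc n)) 0)))

∑₂-flip : ∀ n F → ∑₂ n F ≡ ∑₂ n (flip F)
∑₂-flip zero    F = refl
∑₂-flip (suc n) F = begin
  F 0 (suc n) + ∑₂ n (λ j k → F (suc j) k)   ≡⟨ ℚ.+-comm (F 0 (suc n)) (∑₂ n (λ j k → F (suc j) k)) ⟩
  ∑₂ n (λ j k → F (suc j) k) + F 0 (suc n)   ≡⟨ cong (_+ F 0 (suc n)) (∑₂-flip n (λ j k → F (suc j) k)) ⟩
  ∑₂ n (λ j k → F (suc k) j) + F 0 (suc n)   ≡⟨ ∑₂-snoc n (flip F) ⟨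
  ∑₂ (suc n) (flip F)                        ∎

∑₂-assoc : ∀ n (G : ℕ → ℕ → ℕ → ℚ) →
           ∑₂ n (λ j k → ∑₂ j (λ p q → G p q k)) ≡ ∑₂ n (λ p l → ∑₂ l (λ q k → G p q k))
∑₂-assoc zero    G = refl
∑₂-assoc (suc n) G = begin
  G 0 0 (suc n) + ∑₂ n (λ j k → G 0 (suc j) k + ∑₂ j (λ p q → G (suc p) q k))
    ≡⟨ cong (G 0 0 (suc n) +_) (∑₂-+ n _ _) ⟩
  G 0 0 (suc n) + (∑₂ n (λ j k → G 0 (suc j) k) + ∑₂ n (λ j k → ∑₂ j (λ p q → G (suc p) q k)))
    ≡⟨ ℚ.+-assoc (G 0 0 (suc n)) (∑₂ n (λ j k → G 0 (suc j) k))
                 (∑₂ n (λ j k → ∑₂ j (λ p q → G (suc p) q k))) ⟨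
  ∑₂ (suc n) (G 0) + ∑₂ n (λ j k → ∑₂ j (λ p q → G (suc p) q k))
    ≡⟨ cong (∑₂ (suc n) (G 0) +_) (∑₂-assoc n (λ p q k → G (suc p) q k)) ⟩
  ∑₂ (suc n) (G 0) + ∑₂ n (λ p l → ∑₂ l (λ q k → G (suc p) q k)) ∎

∑₂-swap : ∀ n n′ (G : ℕ → ℕ → ℕ → ℕ → ℚ) →
          ∑₂ n (λ j k → ∑₂ n′ (G j k)) ≡ ∑₂ n′ (λ p q → ∑₂ n (λ j k → G j k p q))
∑₂-swap zero    n′ G = refl
∑₂-swap (suc n) n′ G = trans
  (cong (∑₂ n′ (G 0 (suc n)) +_) (∑₂-swap n n′ (λ j k → G (suc j) k)))
  (sym (∑₂-+ n′ _ _))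

∑₂-isolate : ∀ n F j k → j ℕ.+ k ≡ n → (∀ j′ k′ → j′ ≢ j → F j′ k′ ≡ 0ℚ) → ∑₂ n F ≡ F j k
∑₂-isolate zero    F zero    zero refl z = refl
∑₂-isolate (suc n) F zero    k    refl z = begin
  F 0 (suc n) + ∑₂ n (λ j k → F (suc j) k)   ≡⟨ cong (F 0 (suc n) +_)
                                                  (trans (∑₂-cong n (λ j k _ → z (suc j) k λ ())) (∑₂-0 n)) ⟩
  F 0 (suc n) + 0ℚ                           ≡⟨ ℚ.+-identityʳ _ ⟩
  F 0 (suc n)                                ∎
∑₂-isolate (suc n) F (suc j) k    p    z = begin
  F 0 (suc n) + ∑₂ n (λ j k → F (suc j) k)   ≡⟨ cong (_+ ∑₂ n (λ j k → F (suc j) k)) (z 0 (suc n) λ ()) ⟩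
  0ℚ + ∑₂ n (λ j k → F (suc j) k)            ≡⟨ ℚ.+-identityˡ _ ⟩
  ∑₂ n (λ j k → F (suc j) k)                 ≡⟨ ∑₂-isolate n (λ j k → F (suc j) k) j k (ℕ.suc-injective p)
                                                  (λ j′ k′ ne → z (suc j′) k′ (ne ∘ ℕ.suc-injective)) ⟩
  F (suc j) k                                ∎

record Split (L : List ℤ) (m : ℤ → ℕ) (a b : FinSupp) : Set where
  constructor split
  field
    left  : SuppIn L (at a)
    right : SuppIn L (at b)
    total : ∀ i → i ∈ L → at a i ℕ.+ at b i ≡ m i

open Split

fresh : ∀ {i : ℤ} {L} → Unique (i ∷ L) → i ∉ L
fresh (p AllPairs.∷ _) i∈ = All.lookup p i∈ refl

single⊕-at : ∀ {i} {L} n a → i ∉ L → SuppIn L (at a) → at (single i n ⊕ a) i ≡ n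
single⊕-at {i} n a i∉ c = trans (cong₂ ℕ._+_ (single-at i n) (c i i∉)) (ℕ.+-identityʳ n)

single⊕-off : ∀ {i l} n a → l ≢ i → at (single i n ⊕ a) l ≡ at a l
single⊕-off n a l≢i = cong (ℕ._+ at a _) (single-off n l≢i)

SuppIn-∷ : ∀ {i L} n a → SuppIn L (at a) → SuppIn (i ∷ L) (at (single i n ⊕ a))
SuppIn-∷ n a c l l∉ = trans (single⊕-off n a (l∉ ∘ here)) (c l (l∉ ∘ there))

Split-∷ : ∀ {i L m j k a b} → i ∉ L → j ℕ.+ k ≡ m i → Split L m a b →
          Split (i ∷ L) m (single i j ⊕ a) (single i k ⊕ b)
Split-∷ {i} {L} {m} {j} {k} {a} {b} i∉ p (split l r t) =
  split (SuppIn-∷ j a l) (SuppIn-∷ k b r) tot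
  where
  tot : ∀ x → x ∈ (i ∷ L) → at (single i j ⊕ a) x ℕ.+ at (single i k ⊕ b) x ≡ m x
  tot x (here refl) = trans (cong₂ ℕ._+_ (single⊕-at j a i∉ l) (single⊕-at k b i∉ r)) p
  tot x (there x∈)  = trans (cong₂ ℕ._+_ (single⊕-off j a x≢i) (single⊕-off k b x≢i)) (t x x∈)
    where
    x≢i : x ≢ i
    x≢i refl = i∉ x∈

Cong₂ : (FinSupp → FinSupp → ℚ) → Set
Cong₂ F = ∀ a a′ b b′ → a ≈ᴹ a′ → b ≈ᴹ b′ → F a b ≡ F a′ b′

⊕-congʳ : ∀ c a a′ → a ≈ᴹ a′ → c ⊕ a ≈ᴹ c ⊕ a′
⊕-congʳ c a a′ p i = cong (at c i ℕ.+_) (p i)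

Cong₂-single : ∀ F i j k → Cong₂ F → Cong₂ (λ a b → F (single i j ⊕ a) (single i k ⊕ b))
Cong₂-single F i j k c a a′ b b′ p q =
  c _ _ _ _ (⊕-congʳ (single i j) a a′ p) (⊕-congʳ (single i k) b b′ q)

∑split-cong : ∀ {L} m {F G} → Unique L → (∀ a b → Split L m a b → F a b ≡ G a b) →
              ∑split L m F ≡ ∑split L m G
∑split-cong {[]}    m u p = p 𝟘 𝟘 (split (λ _ _ → refl) (λ _ _ → refl) (λ _ ()))
∑split-cong {i ∷ L} m u@(_ AllPairs.∷ u′) p = ∑₂-cong (m i) λ j k q →
  ∑split-cong m u′ λ a b s → p _ _ (Split-∷ (fresh u) q s)

∑split-ext : ∀ L m {F G} → (∀ a b → F a b ≡ G a b) → ∑split L m F ≡ ∑split L m G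
∑split-ext []      m p = p 𝟘 𝟘
∑split-ext (i ∷ L) m p = ∑₂-cong (m i) λ j k q → ∑split-ext L m λ a b → p _ _

∑split-index : ∀ L {m m′} F → (∀ i → i ∈ L → m i ≡ m′ i) → ∑split L m F ≡ ∑split L m′ F
∑split-index []      F p = refl
∑split-index (i ∷ L) {m} {m′} F p = trans
  (cong (λ n → ∑₂ n (λ j k → ∑split L m (λ a b → F (single i j ⊕ a) (single i k ⊕ b)))) (p i (here refl)))
  (∑₂-cong (m′ i) λ j k _ → ∑split-index L _ (λ l l∈ → p l (there l∈)))

∑split-0 : ∀ L m → ∑split L m (λ _ _ → 0ℚ) ≡ 0ℚ
∑split-0 []      m = refl
∑split-0 (i ∷ L) m = trans (∑₂-cong (m i) (λ _ _ _ → ∑split-0 L m)) (∑₂-0 (m i))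

∑split-vanish : ∀ {L} m {F} → Unique L → (∀ a b → Split L m a b → F a b ≡ 0ℚ) → ∑split L m F ≡ 0ℚ
∑split-vanish {L} m u p = trans (∑split-cong m u p) (∑split-0 L m)

∑split-+ : ∀ L m F G → ∑split L m (λ a b → F a b + G a b) ≡ ∑split L m F + ∑split L m G
∑split-+ []      m F G = refl
∑split-+ (i ∷ L) m F G = trans (∑₂-cong (m i) (λ j k _ → ∑split-+ L m _ _)) (∑₂-+ (m i) _ _)

∑split-* : ∀ L m c F → ∑split L m (λ a b → c * F a b) ≡ c * ∑split L m F
∑split-* []      m c F = refl
∑split-* (i ∷ L) m c F = trans (∑₂-cong (m i) (λ j k _ → ∑split-* L m c _)) (∑₂-* (m i) c _)

∑split-flip : ∀ L m F → ∑split L m F ≡ ∑split L m (flip F)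
∑split-flip []      m F = refl
∑split-flip (i ∷ L) m F = trans (∑₂-flip (m i) _) (∑₂-cong (m i) λ j k _ → ∑split-flip L m _)

∑split-∑₂ : ∀ L m n (H : ℕ → ℕ → FinSupp → FinSupp → ℚ) →
            ∑split L m (λ a b → ∑₂ n (λ p q → H p q a b)) ≡ ∑₂ n (λ p q → ∑split L m (H p q))
∑split-∑₂ L m zero    H = refl
∑split-∑₂ L m (suc n) H = trans (∑split-+ L m _ _)
  (cong (∑split L m (H 0 (suc n)) +_) (∑split-∑₂ L m n (λ p q → H (suc p) q)))

∑split-assoc : ∀ {L} m (G : FinSupp → FinSupp → FinSupp → ℚ) → Unique L →
               ∑split L m (λ s c → ∑split L (at s) (λ a b → G a b c)) ≡
               ∑split L m (λ a s → ∑split L (at s) (λ b c → G a b c))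
∑split-assoc {[]}    m G u = refl
∑split-assoc {i ∷ L} m G u@(_ AllPairs.∷ u′) = begin
  ∑₂ (m i) (λ j k → ∑split L m (λ s c → ∑split (i ∷ L) (at (single i j ⊕ s)) (λ a b → G a b (single i k ⊕ c))))
    ≡⟨ ∑₂-cong (m i) (λ j k _ → trans
         (∑split-cong m u′ (λ s c sp → unfold j s (left sp) (λ a b → G a b (single i k ⊕ c))))
         (∑split-∑₂ L m j _)) ⟩
  ∑₂ (m i) (λ j k → ∑₂ j (λ p q → ∑split L m (λ s c → ∑split L (at s) (λ a b → G′ p q k a b c))))
    ≡⟨ ∑₂-assoc (m i) _ ⟩
  ∑₂ (m i) (λ p l → ∑₂ l (λ q k → ∑split L m (λ s c → ∑split L (at s) (λ a b → G′ p q k a b c))))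
    ≡⟨ ∑₂-cong (m i) (λ p l _ → ∑₂-cong l (λ q k _ → ∑split-assoc m (G′ p q k) u′)) ⟩
  ∑₂ (m i) (λ p l → ∑₂ l (λ q k → ∑split L m (λ a s → ∑split L (at s) (λ b c → G′ p q k a b c))))
    ≡⟨ ∑₂-cong (m i) (λ p l _ → trans
         (∑split-cong m u′ (λ a s sp → unfold l s (right sp) (G (single i p ⊕ a))))
         (∑split-∑₂ L m l _)) ⟨
  ∑₂ (m i) (λ p l → ∑split L m (λ a s → ∑split (i ∷ L) (at (single i l ⊕ s)) (λ b c → G (single i p ⊕ a) b c))) ∎
  where
  G′ : ℕ → ℕ → ℕ → FinSupp → FinSupp → FinSupp → ℚ
  G′ p q k a b c = G (single i p ⊕ a) (single i q ⊕ b) (single i k ⊕ c)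

  unfold : ∀ j s → SuppIn L (at s) → ∀ F →
           ∑split (i ∷ L) (at (single i j ⊕ s)) F ≡
           ∑₂ j (λ p q → ∑split L (at s) (λ a b → F (single i p ⊕ a) (single i q ⊕ b)))
  unfold j s c F = trans
    (cong (λ n → ∑₂ n (λ p q → ∑split L (at (single i j ⊕ s)) (λ a b → F (single i p ⊕ a) (single i q ⊕ b))))
          (single⊕-at j s (fresh u) c))
    (∑₂-cong j (λ p q _ → ∑split-index L _ (λ l l∈ → single⊕-off j s (λ { refl → fresh u l∈ }))))

single-0⊕ : ∀ i a → single i 0 ⊕ a ≈ᴹ a
single-0⊕ i a l with l ℤ.≟ i
... | yes _ = refl
... | no  _ = refl

∑split-filter : ∀ L m {F} → Cong₂ F → ∑split L m F ≡ ∑split (filter (nonzero? m) L) m F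
∑split-filter []      m c = refl
∑split-filter (i ∷ L) m {F} c with m i ℕ.≟ 0
... | no  p = trans
  (∑₂-cong (m i) (λ j k _ → ∑split-filter L m (Cong₂-single F i j k c)))
  (cong (λ L → ∑split L m F) (sym (filter-accept (nonzero? m) {xs = L} p)))
... | yes p = begin
  ∑₂ (m i) (λ j k → ∑split L m (λ a b → F (single i j ⊕ a) (single i k ⊕ b)))
    ≡⟨ cong (λ n → ∑₂ n (λ j k → ∑split L m (λ a b → F (single i j ⊕ a) (single i k ⊕ b)))) p ⟩
  ∑split L m (λ a b → F (single i 0 ⊕ a) (single i 0 ⊕ b))
    ≡⟨ ∑split-ext L m (λ a b → c _ _ _ _ (single-0⊕ i a) (single-0⊕ i b)) ⟩
  ∑split L m F
    ≡⟨ ∑split-filter L m c ⟩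
  ∑split (filter (nonzero? m) L) m F
    ≡⟨ cong (λ L → ∑split L m F) (filter-reject (nonzero? m) {xs = L} (λ q → q p)) ⟨
  ∑split (filter (nonzero? m) (i ∷ L)) m F ∎

⊕-swap : ∀ a b c → a ⊕ (b ⊕ c) ≈ᴹ b ⊕ (a ⊕ c)
⊕-swap a b c i = begin
  at a i ℕ.+ (at b i ℕ.+ at c i)   ≡⟨ ℕ.+-assoc (at a i) (at b i) (at c i) ⟨
  at a i ℕ.+ at b i ℕ.+ at c i     ≡⟨ cong (ℕ._+ at c i) (ℕ.+-comm (at a i) (at b i)) ⟩
  at b i ℕ.+ at a i ℕ.+ at c i     ≡⟨ ℕ.+-assoc (at b i) (at a i) (at c i) ⟩
  at b i ℕ.+ (at a i ℕ.+ at c i)   ∎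

∑split-↭ : ∀ {L L′} m {F} → Cong₂ F → L ↭ L′ → ∑split L m F ≡ ∑split L′ m F
∑split-↭ m c Perm.refl = refl
∑split-↭ m {F} c (Perm.prep i p) = ∑₂-cong (m i) λ j k _ → ∑split-↭ m (Cong₂-single F i j k c) p
∑split-↭ m {F} c (Perm.swap {L} {L′} i l p) = begin
  ∑₂ (m i) (λ j k → ∑₂ (m l) (λ p q → ∑split L m (λ a b →
    F (single i j ⊕ (single l p ⊕ a)) (single i k ⊕ (single l q ⊕ b)))))
    ≡⟨ ∑₂-swap (m i) (m l) _ ⟩
  ∑₂ (m l) (λ p q → ∑₂ (m i) (λ j k → ∑split L m (λ a b →
    F (single i j ⊕ (single l p ⊕ a)) (single i k ⊕ (single l q ⊕ b)))))
    ≡⟨ ∑₂-cong (m l) (λ p q _ → ∑₂-cong (m i) (λ j k _ → ∑split-ext L m (λ a b →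
         c _ _ _ _ (⊕-swap (single i j) (single l p) a) (⊕-swap (single i k) (single l q) b)))) ⟩
  ∑₂ (m l) (λ p q → ∑₂ (m i) (λ j k → ∑split L m (λ a b →
    F (single l p ⊕ (single i j ⊕ a)) (single l q ⊕ (single i k ⊕ b)))))
    ≡⟨ ∑₂-cong (m l) (λ p′ q _ → ∑₂-cong (m i) (λ j k _ →
         ∑split-↭ m (Cong₂-single _ i j k (Cong₂-single F l p′ q c)) p)) ⟩
  ∑₂ (m l) (λ p q → ∑₂ (m i) (λ j k → ∑split L′ m (λ a b →
    F (single l p ⊕ (single i j ⊕ a)) (single l q ⊕ (single i k ⊕ b))))) ∎
∑split-↭ m c (Perm.trans p q) = trans (∑split-↭ m c p) (∑split-↭ m c q)

∑split-cover : ∀ {L L′} m {F} → Cong₂ F → Unique L → Unique L′ → SuppIn L m → SuppIn L′ m →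
               ∑split L m F ≡ ∑split L′ m F
∑split-cover {L} {L′} m {F} cF u u′ c c′ = begin
  ∑split L m F                         ≡⟨ ∑split-filter L m cF ⟩
  ∑split (filter (nonzero? m) L) m F   ≡⟨ ∑split-↭ m cF (filter-↭ m u u′ c c′) ⟩
  ∑split (filter (nonzero? m) L′) m F  ≡⟨ ∑split-filter L′ m cF ⟨
  ∑split L′ m F                        ∎

∑split-relabel : (σ : ℤ ↔ ℤ) {m m′ : ℤ → ℕ} → (∀ i → m′ i ≡ m (Inverse.to σ i)) → ∀ L {F F′} →
  (∀ a a′ b b′ → (∀ i → at a′ i ≡ at a (Inverse.to σ i)) → (∀ i → at b′ i ≡ at b (Inverse.to σ i)) →
     F′ a′ b′ ≡ F a b) →
  ∑split L m′ F′ ≡ ∑split (map (Inverse.to σ) L) m F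
∑split-relabel σ p []      h = h 𝟘 𝟘 𝟘 𝟘 (λ _ → refl) (λ _ → refl)
∑split-relabel σ {m} {m′} p (i ∷ L) {F} {F′} h = trans
  (cong (λ n → ∑₂ n (λ j k → ∑split L m′ (λ a b → F′ (single i j ⊕ a) (single i k ⊕ b)))) (p i))
  (∑₂-cong (m (Inverse.to σ i)) λ j k _ → ∑split-relabel σ p L λ a a′ b b′ q r →
    h _ _ _ _ (λ l → cong₂ ℕ._+_ (sing j l) (q l)) (λ l → cong₂ ℕ._+_ (sing k l) (r l)))
  where
  sing : ∀ n l → at (single i n) l ≡ at (single (Inverse.to σ i) n) (Inverse.to σ l)
  sing n l with l ℤ.≟ i
  ... | yes refl = sym (single-at (Inverse.to σ i) n)
  ... | no  l≢i  = sym (single-off n (l≢i ∘ to-injective σ))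

without : ℤ → FinSupp → FinSupp
without i a = record
  { at     = λ l → if does (l ℤ.≟ i) then 0 else at a l
  ; bound  = bound a
  ; vanish = λ l p → go l (vanish a l p)
  }
  where
  go : ∀ l → at a l ≡ 0 → (if does (l ℤ.≟ i) then 0 else at a l) ≡ 0
  go l p with l ℤ.≟ i
  ... | yes _ = refl
  ... | no  _ = p

without-at : ∀ i a → at (without i a) i ≡ 0
without-at i a = cong (if_then 0 else at a i) (dec-true (i ℤ.≟ i) refl)

without-off : ∀ {i l} a → l ≢ i → at (without i a) l ≡ at a l
without-off {i} {l} a l≢i = cong (if_then 0 else at a l) (dec-false (l ℤ.≟ i) l≢i)

single⊕without : ∀ i a → single i (at a i) ⊕ without i a ≈ᴹ a
single⊕without i a l with l ℤ.≟ i
... | yes refl = ℕ.+-identityʳ _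
... | no  _    = refl

without-SuppIn : ∀ {i L} a → SuppIn (i ∷ L) (at a) → SuppIn L (at (without i a))
without-SuppIn {i} a c l l∉ with l ℤ.≟ i
... | yes _   = refl
... | no  l≢i = c l (λ { (here p) → l≢i p ; (there q) → l∉ q })

∑split-isolate : ∀ {L} m {F} u v → Unique L → Cong₂ F → Split L m u v →
                 (∀ a b → ¬ (a ≈ᴹ u) → F a b ≡ 0ℚ) → ∑split L m F ≡ F u v
∑split-isolate {[]}    m u v un c (split l r t) z = c _ _ _ _ (λ i → sym (l i λ ())) (λ i → sym (r i λ ()))
∑split-isolate {i ∷ L} m {F} u v un@(_ AllPairs.∷ un′) c (split l r t) z = begin
  ∑split (i ∷ L) m F
    ≡⟨ ∑₂-isolate (m i) _ (at u i) (at v i) (t i (here refl)) (λ j k j≢ →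
         ∑split-vanish m un′ (λ a b s → z _ _ (λ eq → j≢
           (trans (sym (single⊕-at j a (fresh un) (left s))) (eq i))))) ⟩
  ∑split L m (λ a b → F (single i (at u i) ⊕ a) (single i (at v i) ⊕ b))
    ≡⟨ ∑split-isolate m (without i u) (without i v) un′ (Cong₂-single F i (at u i) (at v i) c)
         (split (without-SuppIn u l) (without-SuppIn v r) tot)
         (λ a b ne → z _ _ (λ eq → ne (λ x → ℕ.+-cancelˡ-≡ (at (single i (at u i)) x) _ _
           (trans (eq x) (sym (single⊕without i u x)))))) ⟩
  F (single i (at u i) ⊕ without i u) (single i (at v i) ⊕ without i v)
    ≡⟨ c _ _ _ _ (single⊕without i u) (single⊕without i v) ⟩
  F u v ∎
  where
  tot : ∀ x → x ∈ L → at (without i u) x ℕ.+ at (without i v) x ≡ m x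
  tot x x∈ = trans (cong₂ ℕ._+_ (without-off u x≢i) (without-off v x≢i)) (t x (there x∈))
    where
    x≢i : x ≢ i
    x≢i refl = fresh un x∈

record PowerSeries : Set where
  field
    coeff      : FinSupp → ℚ
    coeff-cong : ∀ a b → a ≈ᴹ b → coeff a ≡ coeff b

open PowerSeries public

infix 4 _≈_
infixl 6 _+ˢ_
infixl 7 _*ˢ_
infix 8 -ˢ_

record _≈_ (f g : PowerSeries) : Set where
  constructor coeffwise
  field at-each : ∀ m → coeff f m ≡ coeff g m

open _≈_ public

_+ˢ_ _*ˢ_ : PowerSeries → PowerSeries → PowerSeries
f +ˢ g = record
  { coeff      = λ m → coeff f m + coeff g m
  ; coeff-cong = λ a b p → cong₂ _+_ (coeff-cong f a b p) (coeff-cong g a b p)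
  }

coeff-*-cong : ∀ f g → Cong₂ (λ a b → coeff f a * coeff g b)
coeff-*-cong f g a a′ b b′ p q = cong₂ _*_ (coeff-cong f a a′ p) (coeff-cong g b b′ q)

f *ˢ g = record
  { coeff      = λ m → ∑split (supp m) (at m) (λ a b → coeff f a * coeff g b)
  ; coeff-cong = λ m m′ p → trans
      (∑split-cover (at m) (coeff-*-cong f g) (supp-unique m) (supp-unique m′) (supp-covers m)
        (λ i i∉ → trans (p i) (supp-covers m′ i i∉)))
      (∑split-index (supp m′) _ (λ i _ → p i))
  }

-ˢ_ : PowerSeries → PowerSeries
-ˢ f = record { coeff = λ m → - coeff f m ; coeff-cong = λ a b p → cong -_ (coeff-cong f a b p) }

_•ˢ_ : ℚ → PowerSeries → PowerSeries
c •ˢ f = record { coeff = λ m → c * coeff f m ; coeff-cong = λ a b p → cong (c *_) (coeff-cong f a b p) }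

indicator : {P : Set} → Dec P → ℚ
indicator P? = if does P? then 1ℚ else 0ℚ

indicator-cong : ∀ {P Q : Set} (P? : Dec P) (Q? : Dec Q) → (P → Q) → (Q → P) → indicator P? ≡ indicator Q?
indicator-cong (yes p) (yes q) to from = refl
indicator-cong (yes p) (no ¬q) to from = contradiction (to p) ¬q
indicator-cong (no ¬p) (yes q) to from = contradiction (from q) ¬p
indicator-cong (no ¬p) (no ¬q) to from = refl

indicator-yes : ∀ {P : Set} (P? : Dec P) → P → indicator P? ≡ 1ℚ
indicator-yes P? p = cong (if_then 1ℚ else 0ℚ) (dec-true P? p)

indicator-no : ∀ {P : Set} (P? : Dec P) → ¬ P → indicator P? ≡ 0ℚ
indicator-no P? ¬p = cong (if_then 1ℚ else 0ℚ) (dec-false P? ¬p)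

monomial : FinSupp → PowerSeries
monomial u = record
  { coeff      = λ m → indicator (m ≈ᴹ? u)
  ; coeff-cong = λ a b p → indicator-cong (a ≈ᴹ? u) (b ≈ᴹ? u)
                   (λ q i → trans (sym (p i)) (q i)) (λ q i → trans (p i) (q i))
  }

0ˢ 1ˢ : PowerSeries
0ˢ = record { coeff = λ _ → 0ℚ ; coeff-cong = λ _ _ _ → refl }
1ˢ = monomial 𝟘

varˢ : ℤ → PowerSeries
varˢ i = monomial (single i 1)

split-total : ∀ m {a b} → Split (supp m) (at m) a b → a ⊕ b ≈ᴹ m
split-total m {a} {b} s i with i ∈? supp m
... | yes i∈ = total s i i∈
... | no  i∉ = trans (cong₂ ℕ._+_ (left s i i∉) (right s i i∉)) (sym (supp-covers m i i∉))

*-vanish : ∀ f g m → (∀ a b → a ⊕ b ≈ᴹ m → coeff f a * coeff g b ≡ 0ℚ) → coeff (f *ˢ g) m ≡ 0ℚ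
*-vanish f g m z = ∑split-vanish (at m) (supp-unique m) (λ a b s → z a b (split-total m s))

monomial-* : ∀ u f m v → u ⊕ v ≈ᴹ m → coeff (monomial u *ˢ f) m ≡ coeff f v
monomial-* u f m v p = begin
  coeff (monomial u *ˢ f) m          ≡⟨ ∑split-isolate (at m) u v (supp-unique m) (coeff-*-cong (monomial u) f)
                                          (split (λ i i∉ → ℕ.m+n≡0⇒m≡0 _ (trans (p i) (supp-covers m i i∉)))
                                                 (λ i i∉ → ℕ.m+n≡0⇒n≡0 (at u i) (trans (p i) (supp-covers m i i∉)))
                                                 (λ i _ → p i))
                                          (λ a b a≉u → trans (cong (_* coeff f b) (indicator-no (a ≈ᴹ? u) a≉u))
                                                             (ℚ.*-zeroˡ (coeff f b))) ⟩
  indicator (u ≈ᴹ? u) * coeff f v    ≡⟨ cong (_* coeff f v) (indicator-yes (u ≈ᴹ? u) (λ _ → refl)) ⟩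
  1ℚ * coeff f v                     ≡⟨ ℚ.*-identityˡ (coeff f v) ⟩
  coeff f v                          ∎

≈-isEquivalence : IsEquivalence _≈_
≈-isEquivalence = record
  { refl  = coeffwise λ _ → refl
  ; sym   = λ p → coeffwise λ m → sym (at-each p m)
  ; trans = λ p q → coeffwise λ m → trans (at-each p m) (at-each q m)
  }

*ˢ-cong : ∀ {f f′ g g′} → f ≈ f′ → g ≈ g′ → f *ˢ g ≈ f′ *ˢ g′
*ˢ-cong p q = coeffwise λ m → ∑split-ext (supp m) (at m) λ a b → cong₂ _*_ (at-each p a) (at-each q b)

*ˢ-comm : ∀ f g → f *ˢ g ≈ g *ˢ f
*ˢ-comm f g = coeffwise λ m → trans (∑split-flip (supp m) (at m) _)
  (∑split-ext (supp m) (at m) λ a b → ℚ.*-comm (coeff f b) (coeff g a))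

*ˢ-assoc : ∀ f g h → (f *ˢ g) *ˢ h ≈ f *ˢ (g *ˢ h)
*ˢ-assoc f g h = coeffwise λ m → begin
  ∑split (supp m) (at m) (λ s c → ∑split (supp s) (at s) (λ a b → coeff f a * coeff g b) * coeff h c)
    ≡⟨ ∑split-cong (at m) (supp-unique m) (λ s c sp → lhs m s c (left sp)) ⟩
  ∑split (supp m) (at m) (λ s c → ∑split (supp m) (at s) (λ a b → G a b c))
    ≡⟨ ∑split-assoc (at m) G (supp-unique m) ⟩
  ∑split (supp m) (at m) (λ a s → ∑split (supp m) (at s) (λ b c → G a b c))
    ≡⟨ ∑split-cong (at m) (supp-unique m) (λ a s sp → rhs m a s (right sp)) ⟨
  ∑split (supp m) (at m) (λ a s → coeff f a * ∑split (supp s) (at s) (λ b c → coeff g b * coeff h c)) ∎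
  where
  G : FinSupp → FinSupp → FinSupp → ℚ
  G a b c = coeff f a * (coeff g b * coeff h c)

  rhs : ∀ m a s → SuppIn (supp m) (at s) →
        coeff f a * coeff (g *ˢ h) s ≡ ∑split (supp m) (at s) (λ b c → G a b c)
  rhs m a s c = begin
    coeff f a * coeff (g *ˢ h) s
      ≡⟨ cong (coeff f a *_) (∑split-cover (at s) (coeff-*-cong g h) (supp-unique s) (supp-unique m) (supp-covers s) c) ⟩
    coeff f a * ∑split (supp m) (at s) (λ b c → coeff g b * coeff h c)
      ≡⟨ ∑split-* (supp m) (at s) (coeff f a) _ ⟨
    ∑split (supp m) (at s) (λ b c → G a b c) ∎

  lhs : ∀ m s c → SuppIn (supp m) (at s) →
        coeff (f *ˢ g) s * coeff h c ≡ ∑split (supp m) (at s) (λ a b → G a b c)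
  lhs m s c cov = begin
    coeff (f *ˢ g) s * coeff h c
      ≡⟨ cong (_* coeff h c) (∑split-cover (at s) (coeff-*-cong f g) (supp-unique s) (supp-unique m) (supp-covers s) cov) ⟩
    ∑split (supp m) (at s) (λ a b → coeff f a * coeff g b) * coeff h c
      ≡⟨ ℚ.*-comm (∑split (supp m) (at s) (λ a b → coeff f a * coeff g b)) (coeff h c) ⟩
    coeff h c * ∑split (supp m) (at s) (λ a b → coeff f a * coeff g b)
      ≡⟨ ∑split-* (supp m) (at s) (coeff h c) _ ⟨
    ∑split (supp m) (at s) (λ a b → coeff h c * (coeff f a * coeff g b))
      ≡⟨ ∑split-ext (supp m) (at s) (λ a b → trans (ℚ.*-comm (coeff h c) (coeff f a * coeff g b))
                                                   (ℚ.*-assoc (coeff f a) (coeff g b) (coeff h c))) ⟩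
    ∑split (supp m) (at s) (λ a b → G a b c) ∎

*ˢ-identityˡ : ∀ f → 1ˢ *ˢ f ≈ f
*ˢ-identityˡ f = coeffwise λ m → monomial-* 𝟘 f m m (λ _ → refl)

*ˢ-distribˡ : ∀ f g h → f *ˢ (g +ˢ h) ≈ f *ˢ g +ˢ f *ˢ h
*ˢ-distribˡ f g h = coeffwise λ m → trans
  (∑split-ext (supp m) (at m) (λ a b → ℚ.*-distribˡ-+ (coeff f a) (coeff g b) (coeff h b)))
  (∑split-+ (supp m) (at m) _ _)

≈-setoid : Setoid 0ℓ 0ℓ
≈-setoid = record { isEquivalence = ≈-isEquivalence }

open import Algebra.Consequences.Setoid ≈-setoid using (comm∧idˡ⇒id; comm∧distrˡ⇒distr)

powerSeriesRing : CommutativeRing 0ℓ 0ℓ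
powerSeriesRing = record
  { Carrier = PowerSeries ; _≈_ = _≈_ ; _+_ = _+ˢ_ ; _*_ = _*ˢ_ ; -_ = -ˢ_ ; 0# = 0ˢ ; 1# = 1ˢ
  ; isCommutativeRing = record
    { isRing = record
      { +-isAbelianGroup = record
        { isGroup = record
          { isMonoid = record
            { isSemigroup = record
              { isMagma = record
                { isEquivalence = ≈-isEquivalence
                ; ∙-cong = λ p q → coeffwise λ m → cong₂ _+_ (at-each p m) (at-each q m)
                }
              ; assoc = λ f g h → coeffwise λ m → ℚ.+-assoc (coeff f m) (coeff g m) (coeff h m)
              }
            ; identity = (λ f → coeffwise λ m → ℚ.+-identityˡ (coeff f m))
                       , (λ f → coeffwise λ m → ℚ.+-identityʳ (coeff f m))
            }
          ; inverse = (λ f → coeffwise λ m → ℚ.+-inverseˡ (coeff f m))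
                    , (λ f → coeffwise λ m → ℚ.+-inverseʳ (coeff f m))
          ; ⁻¹-cong = λ p → coeffwise λ m → cong -_ (at-each p m)
          }
        ; comm = λ f g → coeffwise λ m → ℚ.+-comm (coeff f m) (coeff g m)
        }
      ; *-cong = *ˢ-cong
      ; *-assoc = *ˢ-assoc
      ; *-identity = comm∧idˡ⇒id *ˢ-comm *ˢ-identityˡ
      ; distrib = comm∧distrˡ⇒distr (λ p q → coeffwise λ m → cong₂ _+_ (at-each p m) (at-each q m)) *ˢ-comm *ˢ-distribˡ
      }
    ; *-comm = *ˢ-comm
    }
  }
module 𝕊 = CommutativeRing powerSeriesRing
open import Algebra.Properties.Ring 𝕊.ring using (-‿distribʳ-*; -‿+-comm; -0#≈0#)
open import Algebra.Properties.CommutativeSemigroup 𝕊.*-commutativeSemigroup using (interchange)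

-- Coefficientwise: m′ is obtained from m by permuting the exponents along a
-- permutation of the variables x_i, i ≤ 0.
record IsSymmetric⁻ (f : PowerSeries) : Set where
  field
    boundedDegree : ∃ λ D → ∀ m → D ℕ.< degree m → coeff f m ≡ 0ℚ
    variables≤0   : ∀ m i → ℤ.0ℤ ℤ.< i → at m i ≢ 0 → coeff f m ≡ 0ℚ
    symmetric     : (σ : ℤ ↔ ℤ) → (∀ i → ℤ.0ℤ ℤ.< i → Inverse.to σ i ≡ i) →
                    ∀ m m′ → (∀ i → at m′ i ≡ at m (Inverse.to σ i)) → coeff f m′ ≡ coeff f m

open IsSymmetric⁻ public

Λ⁻ : Set
Λ⁻ = ∃ IsSymmetric⁻

IsPolynomial : PowerSeries → Set
IsPolynomial f = ∃ λ (ms : List FinSupp) → ∀ m → coeff f m ≢ 0ℚ → Any (m ≈ᴹ_) ms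

Polynomial : Set
Polynomial = ∃ IsPolynomial

∑⊗ : List (Λ⁻ × Polynomial) → PowerSeries
∑⊗ []                  = 0ˢ
∑⊗ ((s , p) ∷ ts) = proj₁ s *ˢ proj₁ p +ˢ ∑⊗ ts

-- The tensor product is identified with its image in the power series under
-- multiplication s ⊗ p ↦ s p: elements are compared as series only, so the
-- choice of tensor representing a series is immaterial.
record 𝓡 : Set where
  field
    series        : PowerSeries
    tensor        : List (Λ⁻ × Polynomial)
    series≈tensor : series ≈ ∑⊗ tensor

open 𝓡 public

infix 4 _≈ᴿ_
infixl 6 _+ᴿ_
infixl 7 _*ᴿ_
infix 8 -ᴿ_

record _≈ᴿ_ (f g : 𝓡) : Set where
  constructor via-series
  field series-≈ : series f ≈ series g

open _≈ᴿ_ public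

symmetric⁻-* : ∀ {f g} → IsSymmetric⁻ f → IsSymmetric⁻ g → IsSymmetric⁻ (f *ˢ g)
symmetric⁻-* {f} {g} F G = record
  { boundedDegree = proj₁ (boundedDegree F) ℕ.+ proj₁ (boundedDegree G)
                  , λ m D<m → *-vanish f g m (λ a b p → deg a b
                      (subst (_ ℕ.<_) (trans (sym (degree-cong {a ⊕ b} {m} p)) (degree-⊕ a b)) D<m))
  ; variables≤0 = λ m i 0<i m≢0 → *-vanish f g m (λ a b p → var a b i 0<i
                      (λ q → m≢0 (trans (sym (p i)) q)))
  ; symmetric = λ σ fixes m m′ p → trans
      (∑split-relabel σ p (supp m′) (λ a a′ b b′ q r →
        cong₂ _*_ (symmetric F σ fixes a a′ q) (symmetric G σ fixes b b′ r)))
      (∑split-cover (at m) (coeff-*-cong f g)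
        (Unique.map⁺ (to-injective σ) (supp-unique m′)) (supp-unique m)
        (SuppIn-relabel σ p (supp-covers m′)) (supp-covers m))
  }
  where
  zeroL : ∀ a b → coeff f a ≡ 0ℚ → coeff f a * coeff g b ≡ 0ℚ
  zeroL a b p = trans (cong (_* coeff g b) p) (ℚ.*-zeroˡ (coeff g b))
  zeroR : ∀ a b → coeff g b ≡ 0ℚ → coeff f a * coeff g b ≡ 0ℚ
  zeroR a b p = trans (cong (coeff f a *_) p) (ℚ.*-zeroʳ (coeff f a))

  deg : ∀ a b → proj₁ (boundedDegree F) ℕ.+ proj₁ (boundedDegree G) ℕ.< degree a ℕ.+ degree b →
        coeff f a * coeff g b ≡ 0ℚ
  deg a b p with proj₁ (boundedDegree F) ℕ.<? degree a | proj₁ (boundedDegree G) ℕ.<? degree b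
  ... | yes q | _     = zeroL a b (proj₂ (boundedDegree F) a q)
  ... | no _  | yes q = zeroR a b (proj₂ (boundedDegree G) b q)
  ... | no ¬q | no ¬r = contradiction p (ℕ.≤⇒≯ (ℕ.+-mono-≤ (ℕ.≮⇒≥ ¬q) (ℕ.≮⇒≥ ¬r)))

  var : ∀ a b i → ℤ.0ℤ ℤ.< i → at a i ℕ.+ at b i ≢ 0 → coeff f a * coeff g b ≡ 0ℚ
  var a b i 0<i ne with at a i ℕ.≟ 0 | at b i ℕ.≟ 0
  ... | no ¬p | _     = zeroL a b (variables≤0 F a i 0<i ¬p)
  ... | yes _ | no ¬q = zeroR a b (variables≤0 G b i 0<i ¬q)
  ... | yes p | yes q = contradiction (cong₂ ℕ._+_ p q) ne

≢0⇒yes : ∀ {P : Set} (P? : Dec P) → indicator P? ≢ 0ℚ → P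
≢0⇒yes (yes p) _ = p
≢0⇒yes (no _) ne = contradiction refl ne

polynomial-* : ∀ {f g} → IsPolynomial f → IsPolynomial g → IsPolynomial (f *ˢ g)
polynomial-* {f} {g} (ms , F) (ns , G) = cartesianProductWith _⊕_ ms ns , λ m ne →
  decidable-stable (Any.any? (m ≈ᴹ?_) _) (λ ¬any → ne (*-vanish f g m (λ a b p → go m a b p ¬any)))
  where
  go : ∀ m a b → a ⊕ b ≈ᴹ m → ¬ Any (m ≈ᴹ_) (cartesianProductWith _⊕_ ms ns) → coeff f a * coeff g b ≡ 0ℚ
  go m a b p ¬any with coeff f a ℚ.≟ 0ℚ | coeff g b ℚ.≟ 0ℚ
  ... | yes q | _     = trans (cong (_* coeff g b) q) (ℚ.*-zeroˡ (coeff g b))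
  ... | no _  | yes q = trans (cong (coeff f a *_) q) (ℚ.*-zeroʳ (coeff f a))
  ... | no ¬q | no ¬r = contradiction
    (Any.cartesianProductWith⁺ _⊕_ (λ q r i → trans (sym (p i)) (cong₂ ℕ._+_ (q i) (r i))) (F a ¬q) (G b ¬r))
    ¬any

polynomial-neg : ∀ {f} → IsPolynomial f → IsPolynomial (-ˢ f)
polynomial-neg (ms , F) = ms , λ m ne → F m (λ p → ne (cong -_ p))

polynomial-• : ∀ c {f} → IsPolynomial f → IsPolynomial (c •ˢ f)
polynomial-• c (ms , F) = ms , λ m ne → F m (λ p → ne (trans (cong (c *_) p) (ℚ.*-zeroʳ c)))

polynomial-monomial : ∀ u → IsPolynomial (monomial u)
polynomial-monomial u = u ∷ [] , λ m ne → here (≢0⇒yes (m ≈ᴹ? u) ne)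

symmetric⁻-1 : IsSymmetric⁻ 1ˢ
symmetric⁻-1 = record
  { boundedDegree = 0 , λ m 0<m → indicator-no (m ≈ᴹ? 𝟘) (λ p → ℕ.<⇒≢ 0<m (sym (degree-cong {m} {𝟘} p)))
  ; variables≤0   = λ m i _ m≢0 → indicator-no (m ≈ᴹ? 𝟘) (λ p → m≢0 (p i))
  ; symmetric     = λ σ _ m m′ p → indicator-cong (m′ ≈ᴹ? 𝟘) (m ≈ᴹ? 𝟘)
      (λ q i → trans (cong (at m) (sym (Inverse.strictlyInverseˡ σ i)))
                     (trans (sym (p (Inverse.from σ i))) (q (Inverse.from σ i))))
      (λ q i → trans (p i) (q (Inverse.to σ i)))
  }

1Λ : Λ⁻
1Λ = 1ˢ , symmetric⁻-1

1P : Polynomial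
1P = 1ˢ , polynomial-monomial 𝟘

_*⊗_ : Λ⁻ × Polynomial → Λ⁻ × Polynomial → Λ⁻ × Polynomial
((s , S) , (p , P)) *⊗ ((s′ , S′) , (p′ , P′)) =
  (s *ˢ s′ , symmetric⁻-* S S′) , (p *ˢ p′ , polynomial-* {p} {p′} P P′)

_•⊗_ : ℚ → Λ⁻ × Polynomial → Λ⁻ × Polynomial
c •⊗ (s , (p , P)) = s , (c •ˢ p , polynomial-• c {p} P)

-⊗_ : Λ⁻ × Polynomial → Λ⁻ × Polynomial
-⊗ (s , (p , P)) = s , (-ˢ p , polynomial-neg {p} P)

∑⊗-++ : ∀ ts us → ∑⊗ (ts ++ us) ≈ ∑⊗ ts +ˢ ∑⊗ us
∑⊗-++ []       us = 𝕊.sym (𝕊.+-identityˡ (∑⊗ us))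
∑⊗-++ (t ∷ ts) us = 𝕊.trans (𝕊.+-congˡ (∑⊗-++ ts us)) (𝕊.sym (𝕊.+-assoc _ _ _))

∑⊗-neg : ∀ ts → ∑⊗ (map -⊗_ ts) ≈ -ˢ ∑⊗ ts
∑⊗-neg []             = 𝕊.sym -0#≈0#
∑⊗-neg ((s , p) ∷ ts) = 𝕊.trans
  (𝕊.+-cong (𝕊.sym (-‿distribʳ-* (proj₁ s) (proj₁ p))) (∑⊗-neg ts))
  (-‿+-comm _ _)

*ˢ-•ʳ : ∀ c f g → f *ˢ (c •ˢ g) ≈ c •ˢ (f *ˢ g)
*ˢ-•ʳ c f g = coeffwise λ m → trans
  (∑split-ext (supp m) (at m) (λ a b → begin
    coeff f a * (c * coeff g b)   ≡⟨ ℚ.*-assoc (coeff f a) c (coeff g b) ⟨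
    coeff f a * c * coeff g b     ≡⟨ cong (_* coeff g b) (ℚ.*-comm (coeff f a) c) ⟩
    c * coeff f a * coeff g b     ≡⟨ ℚ.*-assoc c (coeff f a) (coeff g b) ⟩
    c * (coeff f a * coeff g b)   ∎))
  (∑split-* (supp m) (at m) c _)

∑⊗-• : ∀ c ts → ∑⊗ (map (c •⊗_) ts) ≈ c •ˢ ∑⊗ ts
∑⊗-• c []             = coeffwise λ _ → sym (ℚ.*-zeroʳ c)
∑⊗-• c ((s , p) ∷ ts) = 𝕊.trans
  (𝕊.+-cong (*ˢ-•ʳ c (proj₁ s) (proj₁ p)) (∑⊗-• c ts))
  (coeffwise λ m → sym (ℚ.*-distribˡ-+ c (coeff (proj₁ s *ˢ proj₁ p) m) (coeff (∑⊗ ts) m)))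

∑⊗-map* : ∀ t us → ∑⊗ (map (t *⊗_) us) ≈ (proj₁ (proj₁ t) *ˢ proj₁ (proj₂ t)) *ˢ ∑⊗ us
∑⊗-map* t []       = 𝕊.sym (𝕊.zeroʳ _)
∑⊗-map* t (u ∷ us) = 𝕊.trans (𝕊.+-cong (interchange _ _ _ _) (∑⊗-map* t us)) (𝕊.sym (𝕊.distribˡ _ _ _))

∑⊗-* : ∀ ts us → ∑⊗ (cartesianProductWith _*⊗_ ts us) ≈ ∑⊗ ts *ˢ ∑⊗ us
∑⊗-* []       us = 𝕊.sym (𝕊.zeroˡ (∑⊗ us))
∑⊗-* (t ∷ ts) us = 𝕊.trans (∑⊗-++ (map (t *⊗_) us) _) (𝕊.trans
  (𝕊.+-cong (∑⊗-map* t us) (∑⊗-* ts us))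
  (𝕊.sym (𝕊.distribʳ (∑⊗ us) _ (∑⊗ ts))))

_+ᴿ_ _*ᴿ_ : 𝓡 → 𝓡 → 𝓡
f +ᴿ g = record
  { series        = series f +ˢ series g
  ; tensor        = tensor f ++ tensor g
  ; series≈tensor = 𝕊.trans (𝕊.+-cong (series≈tensor f) (series≈tensor g)) (𝕊.sym (∑⊗-++ (tensor f) (tensor g)))
  }
f *ᴿ g = record
  { series        = series f *ˢ series g
  ; tensor        = cartesianProductWith _*⊗_ (tensor f) (tensor g)
  ; series≈tensor = 𝕊.trans (𝕊.*-cong (series≈tensor f) (series≈tensor g)) (𝕊.sym (∑⊗-* (tensor f) (tensor g)))
  }

-ᴿ_ : 𝓡 → 𝓡
-ᴿ f = record
  { series        = -ˢ series f
  ; tensor        = map -⊗_ (tensor f)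
  ; series≈tensor = 𝕊.trans (𝕊.-‿cong (series≈tensor f)) (𝕊.sym (∑⊗-neg (tensor f)))
  }

infixr 7 _•ᴿ_

_•ᴿ_ : ℚ → 𝓡 → 𝓡
c •ᴿ f = record
  { series        = c •ˢ series f
  ; tensor        = map (c •⊗_) (tensor f)
  ; series≈tensor = 𝕊.trans (coeffwise λ m → cong (c *_) (at-each (series≈tensor f) m))
                            (𝕊.sym (∑⊗-• c (tensor f)))
  }

fromΛ⁻ : Λ⁻ → 𝓡
fromΛ⁻ s = record
  { series        = proj₁ s
  ; tensor        = (s , 1P) ∷ []
  ; series≈tensor = 𝕊.sym (𝕊.trans (𝕊.+-identityʳ _) (𝕊.*-identityʳ (proj₁ s)))
  }

fromPolynomial : Polynomial → 𝓡
fromPolynomial p = record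
  { series        = proj₁ p
  ; tensor        = (1Λ , p) ∷ []
  ; series≈tensor = 𝕊.sym (𝕊.trans (𝕊.+-identityʳ _) (𝕊.*-identityˡ (proj₁ p)))
  }

0ᴿ 1ᴿ : 𝓡
0ᴿ = record { series = 0ˢ ; tensor = [] ; series≈tensor = 𝕊.refl }
1ᴿ = fromPolynomial 1P

var : ℤ → 𝓡
var i = fromPolynomial (varˢ i , polynomial-monomial (single i 1))

𝓡-ring : CommutativeRing 0ℓ 0ℓ
𝓡-ring = record
  { Carrier = 𝓡 ; _≈_ = _≈ᴿ_ ; _+_ = _+ᴿ_ ; _*_ = _*ᴿ_ ; -_ = -ᴿ_ ; 0# = 0ᴿ ; 1# = 1ᴿ
  ; isCommutativeRing = record
    { isRing = record
      { +-isAbelianGroup = record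
        { isGroup = record
          { isMonoid = record
            { isSemigroup = record
              { isMagma = record
                { isEquivalence = record
                  { refl  = via-series 𝕊.refl
                  ; sym   = λ p → via-series (𝕊.sym (series-≈ p))
                  ; trans = λ p q → via-series (𝕊.trans (series-≈ p) (series-≈ q))
                  }
                ; ∙-cong = λ p q → via-series (𝕊.+-cong (series-≈ p) (series-≈ q))
                }
              ; assoc = λ f g h → via-series (𝕊.+-assoc (series f) (series g) (series h))
              }
            ; identity = (λ f → via-series (𝕊.+-identityˡ (series f)))
                       , (λ f → via-series (𝕊.+-identityʳ (series f)))
            }
          ; inverse = (λ f → via-series (𝕊.-‿inverseˡ (series f)))
                    , (λ f → via-series (𝕊.-‿inverseʳ (series f)))
          ; ⁻¹-cong = λ p → via-series (𝕊.-‿cong (series-≈ p))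
          }
        ; comm = λ f g → via-series (𝕊.+-comm (series f) (series g))
        }
      ; *-cong = λ p q → via-series (𝕊.*-cong (series-≈ p) (series-≈ q))
      ; *-assoc = λ f g h → via-series (𝕊.*-assoc (series f) (series g) (series h))
      ; *-identity = (λ f → via-series (𝕊.*-identityˡ (series f)))
                   , (λ f → via-series (𝕊.*-identityʳ (series f)))
      ; distrib = (λ f g h → via-series (𝕊.distribˡ (series f) (series g) (series h)))
                , (λ f g h → via-series (𝕊.distribʳ (series f) (series g) (series h)))
      }
    ; *-comm = λ f g → via-series (𝕊.*-comm (series f) (series g))
    }
  }

VarsUpTo : ℤ → FinSupp → Set
VarsUpTo k m = ∀ i → k ℤ.< i → at m i ≡ 0

SquareFree : FinSupp → Set
SquareFree m = ∀ i → at m i ℕ.≤ 1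

varsUpTo? : ∀ k m → Dec (VarsUpTo k m)
varsUpTo? k m = ∀supp? m (λ i p _ → p) (λ i → (k ℤ.<? i) →-dec (at m i ℕ.≟ 0))

squareFree? : ∀ m → Dec (SquareFree m)
squareFree? m = ∀supp? m (λ i p → subst (ℕ._≤ 1) (sym p) z≤n) (λ i → at m i ℕ.≤? 1)

varsUpTo-cong : ∀ k a b → a ≈ᴹ b → VarsUpTo k a → VarsUpTo k b
varsUpTo-cong k a b p v i k<i = trans (sym (p i)) (v i k<i)

squareFree-cong : ∀ a b → a ≈ᴹ b → SquareFree a → SquareFree b
squareFree-cong a b p s i = subst (ℕ._≤ 1) (p i) (s i)

EMonomial HMonomial : ℤ → ℕ → FinSupp → Set
EMonomial k d m = VarsUpTo k m × SquareFree m × degree m ≡ d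
HMonomial k d m = VarsUpTo k m × degree m ≡ d

eMonomial? : ∀ k d m → Dec (EMonomial k d m)
eMonomial? k d m = varsUpTo? k m ×-dec squareFree? m ×-dec degree m ℕ.≟ d

hMonomial? : ∀ k d m → Dec (HMonomial k d m)
hMonomial? k d m = varsUpTo? k m ×-dec degree m ℕ.≟ d

eMonomial-cong : ∀ k d a b → a ≈ᴹ b → EMonomial k d a → EMonomial k d b
eMonomial-cong k d a b p (v , s , q) =
  varsUpTo-cong k a b p v , squareFree-cong a b p s , trans (sym (degree-cong {a} {b} p)) q

hMonomial-cong : ∀ k d a b → a ≈ᴹ b → HMonomial k d a → HMonomial k d b
hMonomial-cong k d a b p (v , q) = varsUpTo-cong k a b p v , trans (sym (degree-cong {a} {b} p)) q

-- 𝐞_d(…, x_{k-1}, x_k): the sum of all squarefree monomials of degree d in the x_i with i ≤ k.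
eˢ : ℤ → ℕ → PowerSeries
eˢ k d = record
  { coeff      = λ m → indicator (eMonomial? k d m)
  ; coeff-cong = λ a b p → indicator-cong (eMonomial? k d a) (eMonomial? k d b)
                   (eMonomial-cong k d a b p) (eMonomial-cong k d b a (sym ∘ p))
  }

-- 𝐡_d(…, x_{k-1}, x_k): the sum of all monomials of degree d in the x_i with i ≤ k.
hˢ : ℤ → ℕ → PowerSeries
hˢ k d = record
  { coeff      = λ m → indicator (hMonomial? k d m)
  ; coeff-cong = λ a b p → indicator-cong (hMonomial? k d a) (hMonomial? k d b)
                   (hMonomial-cong k d a b p) (hMonomial-cong k d b a (sym ∘ p))
  }

varsUpTo-relabel : (σ : ℤ ↔ ℤ) → (∀ i → ℤ.0ℤ ℤ.< i → Inverse.to σ i ≡ i) →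
                   ∀ m m′ → (∀ i → at m′ i ≡ at m (Inverse.to σ i)) →
                   ∀ i → ℤ.0ℤ ℤ.< i → at m′ i ≡ at m i
varsUpTo-relabel σ fixes m m′ p i 0<i = trans (p i) (cong (at m) (fixes i 0<i))

squareFree-relabel : (σ : ℤ ↔ ℤ) → ∀ m m′ → (∀ i → at m′ i ≡ at m (Inverse.to σ i)) →
                     SquareFree m′ → SquareFree m
squareFree-relabel σ m m′ p s i = subst (ℕ._≤ 1)
  (trans (p (Inverse.from σ i)) (cong (at m) (Inverse.strictlyInverseˡ σ i))) (s (Inverse.from σ i))

e-symmetric : ∀ d → IsSymmetric⁻ (eˢ ℤ.0ℤ d)
e-symmetric d = record
  { boundedDegree = d , λ m d<m → indicator-no (eMonomial? ℤ.0ℤ d m) (λ (_ , _ , q) → ℕ.<⇒≢ d<m (sym q))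
  ; variables≤0   = λ m i 0<i m≢0 → indicator-no (eMonomial? ℤ.0ℤ d m) (λ (v , _) → m≢0 (v i 0<i))
  ; symmetric     = λ σ fixes m m′ p → let r = varsUpTo-relabel σ fixes m m′ p in
      indicator-cong (eMonomial? ℤ.0ℤ d m′) (eMonomial? ℤ.0ℤ d m)
        (λ (v , s , q) → (λ i 0<i → trans (sym (r i 0<i)) (v i 0<i))
                       , squareFree-relabel σ m m′ p s
                       , trans (sym (degree-relabel σ m m′ p)) q)
        (λ (v , s , q) → (λ i 0<i → trans (r i 0<i) (v i 0<i))
                       , (λ i → subst (ℕ._≤ 1) (sym (p i)) (s (Inverse.to σ i)))
                       , trans (degree-relabel σ m m′ p) q)
  }

h-symmetric : ∀ d → IsSymmetric⁻ (hˢ ℤ.0ℤ d)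
h-symmetric d = record
  { boundedDegree = d , λ m d<m → indicator-no (hMonomial? ℤ.0ℤ d m) (λ (_ , q) → ℕ.<⇒≢ d<m (sym q))
  ; variables≤0   = λ m i 0<i m≢0 → indicator-no (hMonomial? ℤ.0ℤ d m) (λ (v , _) → m≢0 (v i 0<i))
  ; symmetric     = λ σ fixes m m′ p → let r = varsUpTo-relabel σ fixes m m′ p in
      indicator-cong (hMonomial? ℤ.0ℤ d m′) (hMonomial? ℤ.0ℤ d m)
        (λ (v , q) → (λ i 0<i → trans (sym (r i 0<i)) (v i 0<i))
                   , trans (sym (degree-relabel σ m m′ p)) q)
        (λ (v , q) → (λ i 0<i → trans (r i 0<i) (v i 0<i))
                   , trans (degree-relabel σ m m′ p) q)
  }

divide : ℤ → FinSupp → FinSupp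
divide k m = record
  { at     = λ i → if does (i ℤ.≟ k) then ℕ.pred (at m i) else at m i
  ; bound  = bound m
  ; vanish = λ i p → go i (vanish m i p)
  }
  where
  go : ∀ i → at m i ≡ 0 → (if does (i ℤ.≟ k) then ℕ.pred (at m i) else at m i) ≡ 0
  go i p with i ℤ.≟ k
  ... | yes _ = cong ℕ.pred p
  ... | no  _ = p

var⊕divide : ∀ k m → at m k ≢ 0 → single k 1 ⊕ divide k m ≈ᴹ m
var⊕divide k m ne i with i ℤ.≟ k
... | yes refl = ℕ.suc-pred (at m k) {{ℕ.≢-nonZero ne}}
... | no  _    = refl

var-*-zero : ∀ k f m → at m k ≡ 0 → coeff (varˢ k *ˢ f) m ≡ 0ℚ
var-*-zero k f m m≡0 = *-vanish (varˢ k) f m (λ a b p → trans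
  (cong (_* coeff f b) (indicator-no (a ≈ᴹ? single k 1) (λ q → one≢0 (trans (sym (trans (q k) (single-at k 1)))
    (ℕ.m+n≡0⇒m≡0 (at a k) (trans (p k) m≡0))))))
  (ℚ.*-zeroˡ (coeff f b)))
  where
  one≢0 : 1 ≢ 0
  one≢0 ()

i<suc : ∀ i → i ℤ.< ℤ.suc i
i<suc i = ℤ.suc[i]≤j⇒i<j ℤ.≤-refl

varsUpTo-suc : ∀ k m → VarsUpTo k m → VarsUpTo (ℤ.suc k) m
varsUpTo-suc k m v i sk<i = v i (ℤ.<-trans (i<suc k) sk<i)

varsUpTo-pred : ∀ k m → at m (ℤ.suc k) ≡ 0 → VarsUpTo (ℤ.suc k) m → VarsUpTo k m
varsUpTo-pred k m p v i k<i with i ℤ.≟ ℤ.suc k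
... | yes refl = p
... | no  i≢   = v i (ℤ.≤∧≢⇒< (ℤ.i<j⇒suc[i]≤j k<i) (i≢ ∘ sym))

degree-var⊕ : ∀ k m → degree (single k 1 ⊕ m) ≡ suc (degree m)
degree-var⊕ k m = trans (degree-⊕ (single k 1) m) (cong (ℕ._+ degree m) (degree-single k 1))

varsUpTo-var⊕ : ∀ k m → VarsUpTo k m → VarsUpTo k (single k 1 ⊕ m)
varsUpTo-var⊕ k m v i k<i = cong₂ ℕ._+_ (single-off {k} {i} 1 (λ { refl → ℤ.<-irrefl refl k<i })) (v i k<i)

e-recurrence : ∀ k d → eˢ (ℤ.suc k) (suc d) ≈ eˢ k (suc d) +ˢ varˢ (ℤ.suc k) *ˢ eˢ k d
e-recurrence k d = coeffwise go
  where
  k′ : ℤ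
  k′ = ℤ.suc k

  to : ∀ v → EMonomial k′ (suc d) (single k′ 1 ⊕ v) → EMonomial k d v
  to v (w , s , q) = varsUpTo-pred k v v≡0 (λ i p → ℕ.m+n≡0⇒n≡0 (at (single k′ 1) i) (w i p))
                   , (λ i → ℕ.≤-trans (ℕ.m≤n+m (at v i) (at (single k′ 1) i)) (s i))
                   , ℕ.suc-injective (trans (sym (degree-var⊕ k′ v)) q)
    where
    v≡0 : at v k′ ≡ 0
    v≡0 = ℕ.n≤0⇒n≡0 (ℕ.≤-pred (subst (λ z → z ℕ.+ at v k′ ℕ.≤ 1) (single-at k′ 1) (s k′)))

  from : ∀ v → EMonomial k d v → EMonomial k′ (suc d) (single k′ 1 ⊕ v)
  from v (w , s , q) = varsUpTo-var⊕ k′ v (varsUpTo-suc k v w) , sq , trans (degree-var⊕ k′ v) (cong suc q)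
    where
    sq : SquareFree (single k′ 1 ⊕ v)
    sq i with i ℤ.≟ k′
    ... | yes refl = subst (λ z → suc z ℕ.≤ 1) (sym (w k′ (i<suc k))) ℕ.≤-refl
    ... | no  _    = s i

  go : ∀ m → coeff (eˢ k′ (suc d)) m ≡ coeff (eˢ k (suc d)) m + coeff (varˢ k′ *ˢ eˢ k d) m
  go m with at m k′ ℕ.≟ 0
  ... | yes p = begin
    coeff (eˢ k′ (suc d)) m        ≡⟨ indicator-cong (eMonomial? k′ (suc d) m) (eMonomial? k (suc d) m)
                                        (λ (w , r) → varsUpTo-pred k m p w , r)
                                        (λ (w , r) → varsUpTo-suc k m w , r) ⟩
    coeff (eˢ k (suc d)) m         ≡⟨ ℚ.+-identityʳ (coeff (eˢ k (suc d)) m) ⟨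
    coeff (eˢ k (suc d)) m + 0ℚ    ≡⟨ cong (coeff (eˢ k (suc d)) m +_) (var-*-zero k′ (eˢ k d) m p) ⟨
    coeff (eˢ k (suc d)) m + coeff (varˢ k′ *ˢ eˢ k d) m ∎
  ... | no  p = begin
    coeff (eˢ k′ (suc d)) m        ≡⟨ coeff-cong (eˢ k′ (suc d)) (single k′ 1 ⊕ divide k′ m) m (var⊕divide k′ m p) ⟨
    coeff (eˢ k′ (suc d)) (single k′ 1 ⊕ divide k′ m)
      ≡⟨ indicator-cong (eMonomial? k′ (suc d) (single k′ 1 ⊕ divide k′ m)) (eMonomial? k d (divide k′ m))
           (to (divide k′ m)) (from (divide k′ m)) ⟩
    coeff (eˢ k d) (divide k′ m)   ≡⟨ monomial-* (single k′ 1) (eˢ k d) m (divide k′ m) (var⊕divide k′ m p) ⟨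
    coeff (varˢ k′ *ˢ eˢ k d) m    ≡⟨ ℚ.+-identityˡ (coeff (varˢ k′ *ˢ eˢ k d) m) ⟨
    0ℚ + coeff (varˢ k′ *ˢ eˢ k d) m
      ≡⟨ cong (_+ coeff (varˢ k′ *ˢ eˢ k d) m)
           (indicator-no (eMonomial? k (suc d) m) (λ (w , _) → p (w k′ (i<suc k)))) ⟨
    coeff (eˢ k (suc d)) m + coeff (varˢ k′ *ˢ eˢ k d) m ∎

h-recurrence : ∀ k d → hˢ (ℤ.suc k) (suc d) ≈ hˢ k (suc d) +ˢ varˢ (ℤ.suc k) *ˢ hˢ (ℤ.suc k) d
h-recurrence k d = coeffwise go
  where
  k′ : ℤ
  k′ = ℤ.suc k

  to : ∀ v → HMonomial k′ (suc d) (single k′ 1 ⊕ v) → HMonomial k′ d v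
  to v (w , q) = (λ i p → ℕ.m+n≡0⇒n≡0 (at (single k′ 1) i) (w i p))
               , ℕ.suc-injective (trans (sym (degree-var⊕ k′ v)) q)

  from : ∀ v → HMonomial k′ d v → HMonomial k′ (suc d) (single k′ 1 ⊕ v)
  from v (w , q) = varsUpTo-var⊕ k′ v w , trans (degree-var⊕ k′ v) (cong suc q)

  go : ∀ m → coeff (hˢ k′ (suc d)) m ≡ coeff (hˢ k (suc d)) m + coeff (varˢ k′ *ˢ hˢ k′ d) m
  go m with at m k′ ℕ.≟ 0
  ... | yes p = begin
    coeff (hˢ k′ (suc d)) m        ≡⟨ indicator-cong (hMonomial? k′ (suc d) m) (hMonomial? k (suc d) m)
                                        (λ (w , r) → varsUpTo-pred k m p w , r)
                                        (λ (w , r) → varsUpTo-suc k m w , r) ⟩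
    coeff (hˢ k (suc d)) m         ≡⟨ ℚ.+-identityʳ (coeff (hˢ k (suc d)) m) ⟨
    coeff (hˢ k (suc d)) m + 0ℚ    ≡⟨ cong (coeff (hˢ k (suc d)) m +_) (var-*-zero k′ (hˢ k′ d) m p) ⟨
    coeff (hˢ k (suc d)) m + coeff (varˢ k′ *ˢ hˢ k′ d) m ∎
  ... | no  p = begin
    coeff (hˢ k′ (suc d)) m        ≡⟨ coeff-cong (hˢ k′ (suc d)) (single k′ 1 ⊕ divide k′ m) m (var⊕divide k′ m p) ⟨
    coeff (hˢ k′ (suc d)) (single k′ 1 ⊕ divide k′ m)
      ≡⟨ indicator-cong (hMonomial? k′ (suc d) (single k′ 1 ⊕ divide k′ m)) (hMonomial? k′ d (divide k′ m))
           (to (divide k′ m)) (from (divide k′ m)) ⟩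
    coeff (hˢ k′ d) (divide k′ m)  ≡⟨ monomial-* (single k′ 1) (hˢ k′ d) m (divide k′ m) (var⊕divide k′ m p) ⟨
    coeff (varˢ k′ *ˢ hˢ k′ d) m   ≡⟨ ℚ.+-identityˡ (coeff (varˢ k′ *ˢ hˢ k′ d) m) ⟨
    0ℚ + coeff (varˢ k′ *ˢ hˢ k′ d) m
      ≡⟨ cong (_+ coeff (varˢ k′ *ˢ hˢ k′ d) m)
           (indicator-no (hMonomial? k (suc d) m) (λ (w , _) → p (w k′ (i<suc k)))) ⟨
    coeff (hˢ k (suc d)) m + coeff (varˢ k′ *ˢ hˢ k′ d) m ∎

e-zero : ∀ k → eˢ k 0 ≈ 1ˢ
e-zero k = coeffwise λ m → indicator-cong (eMonomial? k 0 m) (m ≈ᴹ? 𝟘)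
  (λ (_ , _ , q) → degree≡0 m q)
  (λ q → (λ i _ → q i) , (λ i → subst (ℕ._≤ 1) (sym (q i)) z≤n) , degree-cong {m} {𝟘} q)

h-zero : ∀ k → hˢ k 0 ≈ 1ˢ
h-zero k = coeffwise λ m → indicator-cong (hMonomial? k 0 m) (m ≈ᴹ? 𝟘)
  (λ (_ , q) → degree≡0 m q)
  (λ q → (λ i _ → q i) , degree-cong {m} {𝟘} q)

record In𝓡 (f : PowerSeries) : Set where
  constructor in𝓡
  field
    element  : 𝓡
    element≈ : f ≈ series element

open In𝓡

toElement : ∀ f → In𝓡 f → 𝓡
toElement f (in𝓡 u p) = record
  { series = f ; tensor = tensor u ; series≈tensor = 𝕊.trans p (series≈tensor u) }

+-solve : ∀ {f g h} → f ≈ g +ˢ h → g ≈ f +ˢ -ˢ h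
+-solve {f} {g} {h} p = 𝕊.sym (𝕊.trans (𝕊.+-congʳ p) (𝕊.trans (𝕊.+-assoc g h (-ˢ h))
  (𝕊.trans (𝕊.+-congˡ (𝕊.-‿inverseʳ h)) (𝕊.+-identityʳ g))))

e-step-up : ∀ k → (∀ d → In𝓡 (eˢ k d)) → ∀ d → In𝓡 (eˢ (ℤ.suc k) d)
e-step-up k e zero    = in𝓡 1ᴿ (e-zero (ℤ.suc k))
e-step-up k e (suc d) = in𝓡 (element (e (suc d)) +ᴿ var (ℤ.suc k) *ᴿ element (e d)) (𝕊.trans
  (e-recurrence k d)
  (𝕊.+-cong (element≈ (e (suc d))) (𝕊.*-congˡ (element≈ (e d)))))

h-step-down : ∀ k → (∀ d → In𝓡 (hˢ (ℤ.suc k) d)) → ∀ d → In𝓡 (hˢ k d)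
h-step-down k h zero    = in𝓡 1ᴿ (h-zero k)
h-step-down k h (suc d) = in𝓡 (element (h (suc d)) +ᴿ -ᴿ (var (ℤ.suc k) *ᴿ element (h d))) (𝕊.trans
  (+-solve (h-recurrence k d))
  (𝕊.+-cong (element≈ (h (suc d))) (𝕊.-‿cong (𝕊.*-congˡ (element≈ (h d))))))

e-step-down : ∀ k → (∀ d → In𝓡 (eˢ (ℤ.suc k) d)) → ∀ d → In𝓡 (eˢ k d)
e-step-down k e zero    = in𝓡 1ᴿ (e-zero k)
e-step-down k e (suc d) = in𝓡 (element (e (suc d)) +ᴿ -ᴿ (var (ℤ.suc k) *ᴿ element rec)) (𝕊.trans
  (+-solve (e-recurrence k d))
  (𝕊.+-cong (element≈ (e (suc d))) (𝕊.-‿cong (𝕊.*-congˡ (element≈ rec)))))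
  where
  rec : In𝓡 (eˢ k d)
  rec = e-step-down k e d

h-step-up : ∀ k → (∀ d → In𝓡 (hˢ k d)) → ∀ d → In𝓡 (hˢ (ℤ.suc k) d)
h-step-up k h zero    = in𝓡 1ᴿ (h-zero (ℤ.suc k))
h-step-up k h (suc d) = in𝓡 (element (h (suc d)) +ᴿ var (ℤ.suc k) *ᴿ element rec) (𝕊.trans
  (h-recurrence k d)
  (𝕊.+-cong (element≈ (h (suc d))) (𝕊.*-congˡ (element≈ rec))))
  where
  rec : In𝓡 (hˢ (ℤ.suc k) d)
  rec = h-step-up k h d

e₀∈𝓡 : ∀ d → In𝓡 (eˢ ℤ.0ℤ d)
e₀∈𝓡 d = in𝓡 (fromΛ⁻ (eˢ ℤ.0ℤ d , e-symmetric d)) 𝕊.refl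

e∈𝓡 : ∀ k d → In𝓡 (eˢ k d)
e∈𝓡 (ℤ.+ zero)   d = e₀∈𝓡 d
e∈𝓡 (ℤ.+ suc n)  d = e-step-up (ℤ.+ n) (e∈𝓡 (ℤ.+ n)) d
e∈𝓡 -[1+ zero ]  d = e-step-down -[1+ 0 ] e₀∈𝓡 d
e∈𝓡 -[1+ suc n ] d = e-step-down -[1+ suc n ] (e∈𝓡 -[1+ n ]) d

h₀∈𝓡 : ∀ d → In𝓡 (hˢ ℤ.0ℤ d)
h₀∈𝓡 d = in𝓡 (fromΛ⁻ (hˢ ℤ.0ℤ d , h-symmetric d)) 𝕊.refl

h∈𝓡 : ∀ k d → In𝓡 (hˢ k d)
h∈𝓡 (ℤ.+ zero)   d = h₀∈𝓡 d
h∈𝓡 (ℤ.+ suc n)  d = h-step-up (ℤ.+ n) (h∈𝓡 (ℤ.+ n)) d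
h∈𝓡 -[1+ zero ]  d = h-step-down -[1+ 0 ] h₀∈𝓡 d
h∈𝓡 -[1+ suc n ] d = h-step-down -[1+ suc n ] (h∈𝓡 -[1+ n ]) d

-- e k d and h k d are 𝐞_d(…, x_{k-1}, x_k) and 𝐡_d(…, x_{k-1}, x_k) as elements of 𝓡;
-- their underlying series are eˢ k d and hˢ k d by definition.
e h : ℤ → ℕ → 𝓡
e k d = toElement (eˢ k d) (e∈𝓡 k d)
h k d = toElement (hˢ k d) (h∈𝓡 k d)

module 𝕽 = CommutativeRing 𝓡-ring

∏ : List ℤ → (ℤ → 𝓡) → 𝓡
∏ L f = foldr (λ i r → f i *ᴿ r) 1ᴿ L

-- The product over all i ∈ ℤ reduces to the window ∣ i ∣ ≤ bound α, since
-- 𝐞_0 = 𝐡_0 = 1 outside of it.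
back-e back-h : FinSupp → 𝓡
back-e α = ∏ (supp α) λ i → e i (at α i)
back-h α = ∏ (supp α) λ i → h i (at α i)

open RingMorphisms 𝕽.rawRing 𝕽.rawRing using (IsRingHomomorphism)

-- 𝐞_r and 𝐡_r in the variables x_i, i ≤ 0, are e 0ℤ r and h 0ℤ r.
record IsLLSInvolution (ω : 𝓡 → 𝓡) : Set where
  field
    isRingHomomorphism : IsRingHomomorphism ω
    •-homo             : ∀ c f → ω (c •ᴿ f) ≈ᴿ c •ᴿ ω f
    involutive         : ∀ f → ω (ω f) ≈ᴿ f
    ω-e                : ∀ r → 1 ℕ.≤ r → ω (e ℤ.0ℤ r) ≈ᴿ h ℤ.0ℤ r
    ω-var              : ∀ i → ω (var i) ≈ᴿ -ᴿ var (ℤ.1ℤ ℤ.- i)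

{-# OPTIONS --safe #-}
-- Write ω for the involution. The recurrences
--   e_{d+1}(≤ k+1) = e_{d+1}(≤ k) + x_{k+1} e_d(≤ k),
--   h_{d+1}(≤ l+1) = h_{d+1}(≤ l) + x_{l+1} h_d(≤ l+1)
-- are exchanged by ω x_{k+1} = - x_{-k} when l + 1 = -k. Hence ω e_d(≤ k) = h_d(≤ -k)
-- propagates from k = 0 to all k in both directions; involutivity gives the same for h.
module Submission where

open import Defs
open import Algebra.Bundles using (CommutativeRing)
open import Algebra.Morphism.Structures using (module RingMorphisms)
import Algebra.Properties.CommutativeSemigroup as CommutativeSemigroupProperties
import Algebra.Properties.Ring as RingProperties
open import Data.Integer.Base as ℤ using (ℤ; -[1+_])
import Data.Integer.Properties as ℤ
open import Data.List.Base using ([]; _∷_)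
open import Data.Nat.Base using (ℕ; zero; suc; z≤n; s≤s)
open import Data.Product.Base using (_×_; _,_)
open import Relation.Binary.PropositionalEquality as ≡ using (_≡_; cong; subst)
import Relation.Binary.Reasoning.Setoid as SetoidReasoning

open RingMorphisms 𝕽.rawRing 𝕽.rawRing using (IsRingHomomorphism)

-- `ω-var` sends `var (suc k)` to minus the variable of index `1ℤ - suc k`, which unfolds to the
-- left side here.
suc[-suc] : ∀ k → ℤ.suc (ℤ.- ℤ.suc k) ≡ ℤ.- k
suc[-suc] k = ≡.trans (cong ℤ.suc (ℤ.neg-distrib-+ ℤ.1ℤ k)) (ℤ.suc-pred (ℤ.- k))

-- Stated over an abstract ring because 𝓡 is an η-record, on which implicit ring elements are not inferred.
module _ {c ℓ} (R : CommutativeRing c ℓ) where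
  open CommutativeRing R renaming (_≈_ to _≋_)
  open RingMorphisms rawRing rawRing using () renaming (IsRingHomomorphism to IsRingEndomorphism)
  open RingProperties ring using (-‿distribˡ-*; //-rightDividesˡ)
  open SetoidReasoning setoid

  homo-subtract : ∀ {ω} → IsRingEndomorphism ω → ∀ {a b x f y g} →
                  a ≋ b + x * f → ω x ≋ - y → ω f ≋ g → ω a + y * g ≋ ω b
  homo-subtract {ω} hom {a} {b} {x} {f} {y} {g} p ωx ωf = begin
    ω a + y * g               ≈⟨ +-congʳ (⟦⟧-cong p) ⟩
    ω (b + x * f) + y * g     ≈⟨ +-congʳ (+-homo b (x * f)) ⟩
    ω b + ω (x * f) + y * g   ≈⟨ +-congʳ (+-congˡ (*-homo x f)) ⟩
    ω b + ω x * ω f + y * g   ≈⟨ +-congʳ (+-congˡ (*-cong ωx ωf)) ⟩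
    ω b + - y * g + y * g     ≈⟨ +-congʳ (+-congˡ (-‿distribˡ-* y g)) ⟨
    ω b + - (y * g) + y * g   ≈⟨ //-rightDividesˡ (y * g) (ω b) ⟩
    ω b                       ∎
    where open IsRingEndomorphism hom

open RingProperties 𝕽.ring using (+-cancelʳ)
open CommutativeSemigroupProperties 𝕽.*-commutativeSemigroup using (x∙yz≈y∙xz)
open SetoidReasoning 𝕽.setoid

∏-cong : ∀ L (f g : ℤ → 𝓡) → (∀ i → f i ≈ᴿ g i) → ∏ L f ≈ᴿ ∏ L g
∏-cong []      f g p = 𝕽.refl {1ᴿ}
∏-cong (i ∷ L) f g p = 𝕽.*-cong {f i} {g i} {∏ L f} {∏ L g} (p i) (∏-cong L f g p)

∏-homo : ∀ {ω} → IsRingHomomorphism ω → ∀ L f → ω (∏ L f) ≈ᴿ ∏ L (λ i → ω (f i))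
∏-homo     hom []      f = IsRingHomomorphism.1#-homo hom
∏-homo {ω} hom (i ∷ L) f = begin
  ω (f i *ᴿ ∏ L f)                 ≈⟨ IsRingHomomorphism.*-homo hom (f i) (∏ L f) ⟩
  ω (f i) *ᴿ ω (∏ L f)             ≈⟨ 𝕽.*-congˡ {ω (f i)} {ω (∏ L f)} {∏ L (λ l → ω (f l))} (∏-homo hom L f) ⟩
  ω (f i) *ᴿ ∏ L (λ l → ω (f l))   ∎

-- `window` lists `suc n` and its negative side by side, so negation only swaps neighbours and one
-- commutation per layer suffices.
∏-window-neg : ∀ n (f : ℤ → 𝓡) → ∏ (window n) (λ i → f (ℤ.- i)) ≈ᴿ ∏ (window n) f
∏-window-neg zero    f = 𝕽.refl {∏ (window 0) f}
∏-window-neg (suc n) f = begin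
  f⁻ *ᴿ (f⁺ *ᴿ F⁻)   ≈⟨ 𝕽.*-congˡ {f⁻} {f⁺ *ᴿ F⁻} {f⁺ *ᴿ F⁺} (𝕽.*-congˡ {f⁺} {F⁻} {F⁺} (∏-window-neg n f)) ⟩
  f⁻ *ᴿ (f⁺ *ᴿ F⁺)   ≈⟨ x∙yz≈y∙xz f⁻ f⁺ F⁺ ⟩
  f⁺ *ᴿ (f⁻ *ᴿ F⁺)   ∎
  where
  f⁺ f⁻ F⁺ F⁻ : 𝓡
  f⁺ = f (ℤ.+ suc n)
  f⁻ = f -[1+ n ]
  F⁺ = ∏ (window n) f
  F⁻ = ∏ (window n) (λ i → f (ℤ.- i))

e-suc : ∀ k d → e (ℤ.suc k) (suc d) ≈ᴿ e k (suc d) +ᴿ var (ℤ.suc k) *ᴿ e k d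
e-suc k d = via-series (e-recurrence k d)

h-suc : ∀ k d → h (ℤ.suc k) (suc d) ≈ᴿ h k (suc d) +ᴿ var (ℤ.suc k) *ᴿ h (ℤ.suc k) d
h-suc k d = via-series (h-recurrence k d)

module _ {ω : 𝓡 → 𝓡} (isLLS : IsLLSInvolution ω) where
  open IsLLSInvolution isLLS
  open IsRingHomomorphism isRingHomomorphism using (⟦⟧-cong; 1#-homo)

  ω-one : ∀ {f g} → f ≈ᴿ 1ᴿ → g ≈ᴿ 1ᴿ → ω f ≈ᴿ g
  ω-one {f} {g} p q = begin
    ω f   ≈⟨ ⟦⟧-cong {f} {1ᴿ} p ⟩
    ω 1ᴿ  ≈⟨ 1#-homo ⟩
    1ᴿ    ≈⟨ q ⟨
    g     ∎

  ω-e-zero : ∀ k l → ω (e k 0) ≈ᴿ h l 0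
  ω-e-zero k l = ω-one {e k 0} {h l 0} (via-series (e-zero k)) (via-series (h-zero l))

  ω-var-suc : ∀ k l → ℤ.suc l ≡ ℤ.- k → ω (var (ℤ.suc k)) ≈ᴿ -ᴿ var (ℤ.suc l)
  ω-var-suc k l q =
    subst (λ i → ω (var (ℤ.suc k)) ≈ᴿ -ᴿ var i) (≡.trans (suc[-suc] k) (≡.sym q)) (ω-var (ℤ.suc k))

  -- Image of the `e`-recurrence under `ω`. The sign of `ω-var-suc` carries the product to the left,
  -- where it equals the last term of `h-suc l d`; both directions of the induction on `k` rest on
  -- this.
  ω-e-+ : ∀ k l d → ℤ.suc l ≡ ℤ.- k → ω (e k d) ≈ᴿ h (ℤ.suc l) d →
          ω (e (ℤ.suc k) (suc d)) +ᴿ var (ℤ.suc l) *ᴿ h (ℤ.suc l) d ≈ᴿ ω (e k (suc d))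
  ω-e-+ k l d q p = homo-subtract 𝓡-ring isRingHomomorphism
    {e (ℤ.suc k) (suc d)} {e k (suc d)} {var (ℤ.suc k)} {e k d} {var (ℤ.suc l)} {h (ℤ.suc l) d}
    (e-suc k d) (ω-var-suc k l q) p

  -- The hypothesis in degrees `d` and `suc d` makes both recurrences share the term `xh`, which
  -- cancels; no induction on `d` is needed.
  ω-e-up : ∀ k l → ℤ.suc l ≡ ℤ.- k → (∀ d → ω (e k d) ≈ᴿ h (ℤ.suc l) d) →
           ∀ d → ω (e (ℤ.suc k) d) ≈ᴿ h l d
  ω-e-up k l q p zero    = ω-e-zero (ℤ.suc k) l
  ω-e-up k l q p (suc d) = +-cancelʳ xh (ω (e (ℤ.suc k) (suc d))) (h l (suc d)) (begin
    ω (e (ℤ.suc k) (suc d)) +ᴿ xh   ≈⟨ ω-e-+ k l d q (p d) ⟩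
    ω (e k (suc d))                 ≈⟨ p (suc d) ⟩
    h (ℤ.suc l) (suc d)             ≈⟨ h-suc l d ⟩
    h l (suc d) +ᴿ xh               ∎)
    where
    xh : 𝓡
    xh = var (ℤ.suc l) *ᴿ h (ℤ.suc l) d

  -- Here the product term involves the unknown identity at `k` in degree `d`, hence the induction
  -- on `d`.
  ω-e-down : ∀ k l → ℤ.suc l ≡ ℤ.- k → (∀ d → ω (e (ℤ.suc k) d) ≈ᴿ h l d) →
             ∀ d → ω (e k d) ≈ᴿ h (ℤ.suc l) d
  ω-e-down k l q p zero    = ω-e-zero k (ℤ.suc l)
  ω-e-down k l q p (suc d) = begin
    ω (e k (suc d))                 ≈⟨ ω-e-+ k l d q (ω-e-down k l q p d) ⟨
    ω (e (ℤ.suc k) (suc d)) +ᴿ xh   ≈⟨ 𝕽.+-congʳ {xh} {ω (e (ℤ.suc k) (suc d))} {h l (suc d)} (p (suc d)) ⟩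
    h l (suc d) +ᴿ xh               ≈⟨ h-suc l d ⟨
    h (ℤ.suc l) (suc d)             ∎
    where
    xh : 𝓡
    xh = var (ℤ.suc l) *ᴿ h (ℤ.suc l) d

  ω-e₀ : ∀ d → ω (e ℤ.0ℤ d) ≈ᴿ h ℤ.0ℤ d
  -- `ω-e` starts at degree 1; in degree 0 both sides are 1.
  ω-e₀ zero    = ω-e-zero ℤ.0ℤ ℤ.0ℤ
  ω-e₀ (suc d) = ω-e (suc d) (s≤s z≤n)

  ω-e-all : ∀ k d → ω (e k d) ≈ᴿ h (ℤ.- k) d
  ω-e-all (ℤ.+ zero)   = ω-e₀
  -- For a variable `n`, neither `ℤ.- (ℤ.+ n)` nor `ℤ.suc -[1+ n ]` reduces, hence the transport; in
  -- the negative cases the indices compute.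
  ω-e-all (ℤ.+ suc n)  = ω-e-up (ℤ.+ n) -[1+ n ] (suc[-suc] (ℤ.+ n)) λ d →
    subst (λ l → ω (e (ℤ.+ n) d) ≈ᴿ h l d) (≡.sym (suc[-suc] (ℤ.+ n))) (ω-e-all (ℤ.+ n) d)
  ω-e-all -[1+ zero ]  = ω-e-down -[1+ 0 ] ℤ.0ℤ ≡.refl ω-e₀
  ω-e-all -[1+ suc n ] = ω-e-down -[1+ suc n ] (ℤ.+ suc n) ≡.refl (ω-e-all -[1+ n ])

  ω-h-all : ∀ k d → ω (h k d) ≈ᴿ e (ℤ.- k) d
  ω-h-all k d = begin
    ω (h k d)                 ≡⟨ cong (λ l → ω (h l d)) (ℤ.neg-involutive k) ⟨
    ω (h (ℤ.- ℤ.- k) d)       ≈⟨ ⟦⟧-cong {ω (e (ℤ.- k) d)} {h (ℤ.- ℤ.- k) d} (ω-e-all (ℤ.- k) d) ⟨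
    ω (ω (e (ℤ.- k) d))       ≈⟨ involutive (e (ℤ.- k) d) ⟩
    e (ℤ.- k) d               ∎

  -- Serves both halves of the theorem. `reversal` keeps `bound`, so both products run over the same
  -- window and reindexing by negation is all that remains.
  ω-∏ : {f g : ℤ → ℕ → 𝓡} → (∀ k d → ω (f k d) ≈ᴿ g (ℤ.- k) d) → ∀ α →
        ω (∏ (supp α) λ i → f i (at α i)) ≈ᴿ ∏ (supp (reversal α)) λ i → g i (at (reversal α) i)
  ω-∏ {f} {g} p α = begin
    ω (∏ (supp α) f∘α)                ≈⟨ ∏-homo isRingHomomorphism (supp α) f∘α ⟩
    ∏ (supp α) (λ i → ω (f∘α i))      ≈⟨ ∏-cong (supp α) (λ i → ω (f∘α i)) (λ i → g∘α̂ (ℤ.- i)) step ⟩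
    ∏ (supp α) (λ i → g∘α̂ (ℤ.- i))    ≈⟨ ∏-window-neg (bound α) g∘α̂ ⟩
    ∏ (supp α) g∘α̂                    ∎
    where
    f∘α g∘α̂ : ℤ → 𝓡
    f∘α i = f i (at α i)
    g∘α̂ i = g i (at (reversal α) i)

    step : ∀ i → ω (f∘α i) ≈ᴿ g∘α̂ (ℤ.- i)
    -- The exponent of `reversal α` at `- i` is that of `α` at `- - i`.
    step i = subst (λ j → ω (f∘α i) ≈ᴿ g (ℤ.- i) (at α j)) (≡.sym (ℤ.neg-involutive i)) (p i (at α i))

theorem4p4 : (ω̃ : 𝓡 → 𝓡) → IsLLSInvolution ω̃ → (α : FinSupp) →
    ω̃ (back-e α) ≈ᴿ back-h (reversal α) × ω̃ (back-h α) ≈ᴿ back-e (reversal α)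
theorem4p4 ω̃ isLLS α = ω-∏ isLLS {e} {h} (ω-e-all isLLS) α , ω-∏ isLLS {h} {e} (ω-h-all isLLS) α
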